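{- Let $n,k$ be positive integers with $n>k$. Let $\mathcal{S}$ be an $n$-element subset of $\mathbb{E}^k$ whose points are not all contained in any $(k-1)$-dimensional hyperplane (affine subspace of dimension $k-1$). If the points of $\mathbb{E}^k$ are colored in finitely many colors (i.e. $\chi:\mathbb{E}^k\to\{1,\ldots,c\}$ is an arbitrary function for some positive integer $c$), then there exists a set of $2^{\aleph_0}$ positive real numbers $r$ such that for each such $r$ there exists a family of cardinality $2^{\aleph_0}$ of pairwise-disjoint monochromatic subsets of $\mathbb{E}^k$, each homothetic to $\mathcal{S}$ with dilation factor $r$.
   Context: $\mathbb{E}^k$ denotes $k$-dimensional Euclidean space (i.e. $\mathbb{R}^k$). For $\mathcal{X}\subseteq\mathbb{E}^k$, $r\in\mathbb{R}$ and $\mathbf{a}\in\mathbb{E}^k$, $\mathbf{a}+r\mathcal{X}=\{\mathbf{a}+r\mathbf{x}:\mathbf{x}\in\mathcal{X}\}$. A subset of $\mathbb{E}^k$ is homothetic to $\mathcal{S}$ with dilation factor $r>0$ if it is of the form $\mathbf{a}+r\mathcal{S}$ for some $\mathbf{a}\in\mathbb{E}^k$. A set is monochromatic if all its points receive the same color. -}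

module Defs where

open import Data.Bool.Base using (Bool)
open import Data.Fin.Base using (Fin)
open import Data.Nat.Base as ℕ using (ℕ; zero; suc)
import Data.Nat.Properties as ℕₚ
open import Data.Product.Base using (Σ; ∃; ∃-syntax; _×_; _,_; proj₁; proj₂)
open import Data.Rational.Base as ℚ
  using (ℚ; 0ℚ; 1ℚ; ½; ∣_∣; Positive; NonNegative; positive; nonNegative)
import Data.Rational.Properties as ℚₚ
open import Data.Rational.Solver using (module +-*-Solver)
open import Data.Sum.Base using (inj₁; inj₂)
open import Data.Vec.Functional using (Vector; foldr; zipWith; replicate)
  renaming (map to mapᵥ)
import Data.Vec.Functional.Relation.Binary.Equality.Setoid as VecEq
open import Function.Bundles using (Func; Bijection)
open import Level using (0ℓ; _⊔_)
open import Relation.Binary.Bundles using (Setoid)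
import Relation.Binary.Construct.On as On
open import Relation.Binary.PropositionalEquality
  using (_≡_; refl; sym; trans; cong; subst; setoid; _→-setoid_)
open import Relation.Nullary using (¬_)
open import Relation.Unary using (Pred; _∈_; _≐_; _⊥_)

-- Real numbers: Cauchy sequences of rationals, with `_≈ᴿ_` (the
-- difference tends to 0) as the setoid equality.

IsCauchy : (ℕ → ℚ) → Set
IsCauchy x = ∀ ε → 0ℚ ℚ.< ε →
  ∃[ N ] (∀ m n → N ℕ.≤ m → N ℕ.≤ n → ∣ x m ℚ.- x n ∣ ℚ.< ε)

record ℝ : Set where
  constructor mkℝ
  field
    seq    : ℕ → ℚ
    cauchy : IsCauchy seq

open ℝ public

infix 4 _≈ᴿ_ _<ᴿ_

_≈ᴿ_ : ℝ → ℝ → Set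
x ≈ᴿ y = ∀ ε → 0ℚ ℚ.< ε →
  ∃[ N ] (∀ n → N ℕ.≤ n → ∣ seq x n ℚ.- seq y n ∣ ℚ.< ε)

-- The gap ε must not depend on n: eventual pointwise `<` would also hold
-- between distinct representatives of the same real.
_<ᴿ_ : ℝ → ℝ → Set
x <ᴿ y = ∃[ ε ] (0ℚ ℚ.< ε ×
  ∃[ N ] (∀ n → N ℕ.≤ n → seq x n ℚ.+ ε ℚ.≤ seq y n))

private
  open +-*-Solver using (solve; _:=_; _:+_; _:*_; :-_; _:-_; con)

  half-pos : ∀ {ε} → 0ℚ ℚ.< ε → 0ℚ ℚ.< ½ ℚ.* ε
  half-pos {ε} 0<ε = ℚₚ.positive⁻¹ (½ ℚ.* ε)
    {{ℚₚ.pos*pos⇒pos ½ ε {{positive 0<ε}}}}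

  halves : ∀ ε → ½ ℚ.* ε ℚ.+ ½ ℚ.* ε ≡ ε
  halves ε = trans (sym (ℚₚ.*-distribʳ-+ ε ½ ½)) (ℚₚ.*-identityˡ ε)

  ∣-∣-comm : ∀ p q → ∣ p ℚ.- q ∣ ≡ ∣ q ℚ.- p ∣
  ∣-∣-comm p q = trans
    (cong ∣_∣ (solve 2 (λ a b → a :- b := :- (b :- a)) refl p q))
    (ℚₚ.∣-p∣≡∣p∣ (q ℚ.- p))

  triangle : ∀ p q r → ∣ p ℚ.- r ∣ ℚ.≤ ∣ p ℚ.- q ∣ ℚ.+ ∣ q ℚ.- r ∣
  triangle p q r = subst (λ t → ∣ t ∣ ℚ.≤ ∣ p ℚ.- q ∣ ℚ.+ ∣ q ℚ.- r ∣)
    (solve 3 (λ a b c → (a :- b) :+ (b :- c) := a :- c) refl p q r)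
    (ℚₚ.∣p+q∣≤∣p∣+∣q∣ (p ℚ.- q) (q ℚ.- r))

  seqSum : (ℕ → ℚ) → ℕ → ℚ
  seqSum x zero    = ∣ x zero ∣
  seqSum x (suc n) = seqSum x n ℚ.+ ∣ x (suc n) ∣

  ≤-+ʳ : ∀ p q → 0ℚ ℚ.≤ q → p ℚ.≤ p ℚ.+ q
  ≤-+ʳ p q 0≤q = subst (ℚ._≤ p ℚ.+ q) (ℚₚ.+-identityʳ p) (ℚₚ.+-monoʳ-≤ p 0≤q)

  ≤-+ˡ : ∀ p q → 0ℚ ℚ.≤ q → p ℚ.≤ q ℚ.+ p
  ≤-+ˡ p q 0≤q = subst (ℚ._≤ q ℚ.+ p) (ℚₚ.+-identityˡ p) (ℚₚ.+-monoˡ-≤ p 0≤q)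

  0≤seqSum : ∀ x n → 0ℚ ℚ.≤ seqSum x n
  0≤seqSum x zero    = ℚₚ.0≤∣p∣ (x zero)
  0≤seqSum x (suc n) = ℚₚ.≤-trans (0≤seqSum x n) (≤-+ʳ _ _ (ℚₚ.0≤∣p∣ (x (suc n))))

  seqSum-bound : ∀ x n i → i ℕ.≤ n → ∣ x i ∣ ℚ.≤ seqSum x n
  seqSum-bound x zero    zero    _   = ℚₚ.≤-refl
  seqSum-bound x (suc n) i       i≤n with ℕₚ.m≤n⇒m<n∨m≡n i≤n
  ... | inj₁ (ℕ.s≤s i≤n′) =
        ℚₚ.≤-trans (seqSum-bound x n i i≤n′) (≤-+ʳ _ _ (ℚₚ.0≤∣p∣ (x (suc n))))
  ... | inj₂ refl = ≤-+ˡ _ _ (0≤seqSum x n)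

cauchy-bounded : ∀ x → IsCauchy x → ∃[ B ] (0ℚ ℚ.< B × (∀ n → ∣ x n ∣ ℚ.≤ B))
cauchy-bounded x cx with cx 1ℚ (ℚₚ.positive⁻¹ 1ℚ)
... | N , close = B , 0<B , bound
  where
  0≤1 : 0ℚ ℚ.≤ 1ℚ
  0≤1 = ℚₚ.<⇒≤ (ℚₚ.positive⁻¹ 1ℚ)

  B : ℚ
  B = 1ℚ ℚ.+ seqSum x N

  0<B : 0ℚ ℚ.< B
  0<B = ℚₚ.<-≤-trans (ℚₚ.positive⁻¹ 1ℚ) (≤-+ʳ _ _ (0≤seqSum x N))

  bound : ∀ n → ∣ x n ∣ ℚ.≤ B
  bound n with ℕₚ.≤-total n N
  ... | inj₁ n≤N = ℚₚ.≤-trans (seqSum-bound x N n n≤N) (≤-+ˡ _ _ 0≤1)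
  ... | inj₂ N≤n = subst (λ t → ∣ t ∣ ℚ.≤ B)
          (solve 2 (λ a b → (a :- b) :+ b := a) refl (x n) (x N))
          (ℚₚ.≤-trans (ℚₚ.∣p+q∣≤∣p∣+∣q∣ (x n ℚ.- x N) (x N))
            (ℚₚ.+-mono-≤ (ℚₚ.<⇒≤ (close n N N≤n ℕₚ.≤-refl))
                         (seqSum-bound x N N ℕₚ.≤-refl)))

0ᴿ : ℝ
0ᴿ = mkℝ (λ _ → 0ℚ) λ ε 0<ε → 0 , λ _ _ _ _ → 0<ε

infixl 6 _+ᴿ_
infixl 7 _*ᴿ_

_+ᴿ_ : ℝ → ℝ → ℝ
mkℝ x cx +ᴿ mkℝ y cy = mkℝ (λ n → x n ℚ.+ y n) c
  where
  c : IsCauchy (λ n → x n ℚ.+ y n)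
  c ε 0<ε with cx (½ ℚ.* ε) (half-pos 0<ε) | cy (½ ℚ.* ε) (half-pos 0<ε)
  ... | M , hx | N , hy = M ℕ.⊔ N , λ m n m≥ n≥ →
    subst (∣ (x m ℚ.+ y m) ℚ.- (x n ℚ.+ y n) ∣ ℚ.<_) (halves ε)
      (ℚₚ.≤-<-trans
        (subst (λ t → ∣ t ∣ ℚ.≤ ∣ x m ℚ.- x n ∣ ℚ.+ ∣ y m ℚ.- y n ∣)
          (solve 4 (λ a b c d → (a :- b) :+ (c :- d) := (a :+ c) :- (b :+ d))
             refl (x m) (x n) (y m) (y n))
          (ℚₚ.∣p+q∣≤∣p∣+∣q∣ (x m ℚ.- x n) (y m ℚ.- y n)))
        (ℚₚ.+-mono-<
          (hx m n (ℕₚ.m⊔n≤o⇒m≤o M N m≥) (ℕₚ.m⊔n≤o⇒m≤o M N n≥))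
          (hy m n (ℕₚ.m⊔n≤o⇒n≤o M N m≥) (ℕₚ.m⊔n≤o⇒n≤o M N n≥))))

_*ᴿ_ : ℝ → ℝ → ℝ
mkℝ x cx *ᴿ mkℝ y cy = mkℝ (λ n → x n ℚ.* y n) c
  where
  -- a · e < ½ε whenever a ≤ B and e < ½ε / B
  module Scale (B : ℚ) (0<B : 0ℚ ℚ.< B) (ε : ℚ) (0<ε : 0ℚ ℚ.< ε) where
    instance
      posB : Positive B
      posB = positive 0<B
      nzB : ℚ.NonZero B
      nzB = ℚₚ.pos⇒nonZero B
      nnB : NonNegative B
      nnB = nonNegative (ℚₚ.<⇒≤ 0<B)

    δ : ℚ
    δ = (ℚ.1/ B) ℚ.* (½ ℚ.* ε)

    0<δ : 0ℚ ℚ.< δ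
    0<δ = ℚₚ.positive⁻¹ δ
      {{ℚₚ.pos*pos⇒pos (ℚ.1/ B) {{ℚₚ.1/pos⇒pos B}} (½ ℚ.* ε)
          {{positive (half-pos 0<ε)}}}}

    Bδ : B ℚ.* δ ≡ ½ ℚ.* ε
    Bδ = trans (sym (ℚₚ.*-assoc B (ℚ.1/ B) (½ ℚ.* ε)))
               (trans (cong (ℚ._* (½ ℚ.* ε)) (ℚₚ.*-inverseʳ B))
                      (ℚₚ.*-identityˡ (½ ℚ.* ε)))

    small : ∀ a e → ∣ a ∣ ℚ.≤ B → ∣ e ∣ ℚ.< δ → ∣ a ℚ.* e ∣ ℚ.< ½ ℚ.* ε
    small a e a≤B e<δ = subst (ℚ._< ½ ℚ.* ε) (sym (ℚₚ.∣p*q∣≡∣p∣*∣q∣ a e))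
      (ℚₚ.≤-<-trans
        (ℚₚ.*-monoʳ-≤-nonNeg ∣ e ∣ {{nonNegative (ℚₚ.0≤∣p∣ e)}} a≤B)
        (subst (B ℚ.* ∣ e ∣ ℚ.<_) Bδ (ℚₚ.*-monoʳ-<-pos B e<δ)))

  c : IsCauchy (λ n → x n ℚ.* y n)
  c ε 0<ε with cauchy-bounded x cx | cauchy-bounded y cy
  ... | A , 0<A , x≤A | B , 0<B , y≤B
    with cy (Scale.δ A 0<A ε 0<ε) (Scale.0<δ A 0<A ε 0<ε)
       | cx (Scale.δ B 0<B ε 0<ε) (Scale.0<δ B 0<B ε 0<ε)
  ... | M , hy | N , hx = M ℕ.⊔ N , λ m n m≥ n≥ →
    subst (∣ (x m ℚ.* y m) ℚ.- (x n ℚ.* y n) ∣ ℚ.<_) (halves ε)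
      (ℚₚ.≤-<-trans
        (subst (λ t → ∣ t ∣ ℚ.≤ ∣ x m ℚ.* (y m ℚ.- y n) ∣ ℚ.+ ∣ y n ℚ.* (x m ℚ.- x n) ∣)
          (solve 4 (λ a b c d → a :* (c :- d) :+ d :* (a :- b) := (a :* c) :- (b :* d))
             refl (x m) (x n) (y m) (y n))
          (ℚₚ.∣p+q∣≤∣p∣+∣q∣ (x m ℚ.* (y m ℚ.- y n)) (y n ℚ.* (x m ℚ.- x n))))
        (ℚₚ.+-mono-<
          (Scale.small A 0<A ε 0<ε (x m) (y m ℚ.- y n) (x≤A m)
            (hy m n (ℕₚ.m⊔n≤o⇒m≤o M N m≥) (ℕₚ.m⊔n≤o⇒m≤o M N n≥)))
          (Scale.small B 0<B ε 0<ε (y n) (x m ℚ.- x n) (y≤B n)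
            (hx m n (ℕₚ.m⊔n≤o⇒n≤o M N m≥) (ℕₚ.m⊔n≤o⇒n≤o M N n≥)))))

ℝ-setoid : Setoid 0ℓ 0ℓ
ℝ-setoid = record
  { Carrier = ℝ
  ; _≈_ = _≈ᴿ_
  ; isEquivalence = record
    { refl = λ {x} ε 0<ε → 0 , λ n _ →
        subst (λ t → ∣ t ∣ ℚ.< ε) (sym (ℚₚ.+-inverseʳ (seq x n))) 0<ε
    ; sym = λ {x} {y} x≈y ε 0<ε → proj₁ (x≈y ε 0<ε) , λ n n≥ →
        subst (ℚ._< ε) (∣-∣-comm (seq x n) (seq y n)) (proj₂ (x≈y ε 0<ε) n n≥)
    ; trans = λ {x} {y} {z} x≈y y≈z ε 0<ε →
        let M , h = x≈y (½ ℚ.* ε) (half-pos 0<ε)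
            N , k = y≈z (½ ℚ.* ε) (half-pos 0<ε)
        in M ℕ.⊔ N , λ n n≥ →
          subst (∣ seq x n ℚ.- seq z n ∣ ℚ.<_) (halves ε)
            (ℚₚ.≤-<-trans (triangle (seq x n) (seq y n) (seq z n))
              (ℚₚ.+-mono-< (h n (ℕₚ.m⊔n≤o⇒m≤o M N n≥))
                           (k n (ℕₚ.m⊔n≤o⇒n≤o M N n≥))))
    }
  }

𝔼 : ℕ → Set
𝔼 k = Vector ℝ k

𝔼-setoid : ℕ → Setoid 0ℓ 0ℓ
𝔼-setoid = VecEq.≋-setoid ℝ-setoid

infix  4 _≈ᴱ_
infixl 6 _+ᴱ_
infixr 7 _·ᴱ_

_≈ᴱ_ : ∀ {k} → 𝔼 k → 𝔼 k → Set
_≈ᴱ_ {k} = Setoid._≈_ (𝔼-setoid k)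

0ᴱ : ∀ {k} → 𝔼 k
0ᴱ {k} = replicate k 0ᴿ

_+ᴱ_ : ∀ {k} → 𝔼 k → 𝔼 k → 𝔼 k
_+ᴱ_ = zipWith _+ᴿ_

_·ᴱ_ : ∀ {k} → ℝ → 𝔼 k → 𝔼 k
r ·ᴱ x = mapᵥ (r *ᴿ_) x

linComb : ∀ {k d} → Vector ℝ d → Vector (𝔼 k) d → 𝔼 k
linComb t v = foldr _+ᴱ_ 0ᴱ (zipWith _·ᴱ_ t v)

LinearlyIndependent : ∀ {k d} → Vector (𝔼 k) d → Set
LinearlyIndependent {d = d} v =
  ∀ (t : Vector ℝ d) → linComb t v ≈ᴱ 0ᴱ → ∀ i → t i ≈ᴿ 0ᴿ

-- Subsets of a setoid are represented by predicates on its carrier.  A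
-- predicate need not respect the setoid equality; it then stands for the
-- set of all elements equal to one satisfying it.

IsAffineSubspace : ∀ {k} → ℕ → Pred (𝔼 k) 0ℓ → Set
IsAffineSubspace {k} d H =
  Σ (𝔼 k) λ p → Σ (Vector (𝔼 k) d) λ v →
    LinearlyIndependent v × H ≐ (λ x → ∃[ t ] x ≈ᴱ p +ᴱ linComb t v)

infix 6 _+[_]_

_+[_]_ : ∀ {k} → 𝔼 k → ℝ → Pred (𝔼 k) 0ℓ → Pred (𝔼 k) 0ℓ
(a +[ r ] X) y = ∃[ x ] (x ∈ X × y ≈ᴱ a +ᴱ r ·ᴱ x)

HomotheticTo : ∀ {k} → Pred (𝔼 k) 0ℓ → ℝ → Pred (𝔼 k) 0ℓ → Set
HomotheticTo S r Y = 0ᴿ <ᴿ r × ∃[ a ] Y ≐ a +[ r ] S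

-- `Func` is a map respecting equality, i.e. a function on actual points.
Coloring : ℕ → ℕ → Set
Coloring k c = Func (𝔼-setoid k) (setoid (Fin c))

Monochromatic : ∀ {k c} → Coloring k c → Pred (𝔼 k) 0ℓ → Set
Monochromatic χ Y = ∀ x y → x ∈ Y → y ∈ Y → Func.to χ x ≡ Func.to χ y

subsetoid : ∀ {a ℓ p} (A : Setoid a ℓ) → Pred (Setoid.Carrier A) p → Setoid (a ⊔ p) ℓ
subsetoid A P = On.setoid {B = ∃ P} A proj₁

HasCardinalityOf : ∀ {x ξ a ℓ p} → Setoid x ξ →
  (A : Setoid a ℓ) → Pred (Setoid.Carrier A) p → Set _
HasCardinalityOf X A P = Bijection X (subsetoid A P)

finite : ℕ → Setoid 0ℓ 0ℓ
finite n = setoid (Fin n)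

-- 2^ℵ₀ as the set of 0-1 sequences, compared pointwise.
continuum : Setoid 0ℓ 0ℓ
continuum = ℕ →-setoid Bool

PairwiseDisjoint : ∀ {k} → Pred (Pred (𝔼 k) 0ℓ) 0ℓ → Set₁
PairwiseDisjoint 𝓕 = ∀ Y Z → Y ∈ 𝓕 → Z ∈ 𝓕 → ¬ (Y ≐ Z) → Y ⊥ Z

{-# OPTIONS --safe #-}

-- Gallai's theorem, proved by colour focusing in an arbitrary commutative monoid, yields a finite
-- list of homotheties one of which makes S monochromatic, whatever the colouring.  Apply it to all
-- the colourings x ↦ χ (a + s x), where s = 1 + (a point of the Cantor set) and a = δ t (1 , … , 1)
-- with t in the Cantor set.  A finite partition of the continuum has a class of size continuum, so
-- for each s the same homothety x ↦ v + d x serves continuum many t, and then the same (v , d)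
-- serves continuum many s.  The ratios are r = s d ≥ 1, and the copies a + s v + r S for a fixed s
-- are disjoint, because the translations a differ by at most δ while distinct points of r S are at
-- least 2 δ apart.
module Submission where

open import Defs
open import Axiom.ExcludedMiddle using (ExcludedMiddle)
open import Axiom.Extensionality.Propositional using (Extensionality)
open import Data.Nat.Base using (ℕ; _≤_; _<_; _∸_)
open import Data.Product.Base using (Σ; _×_)
open import Level using (0ℓ)
open import Relation.Nullary using (¬_)
open import Relation.Unary using (Pred; _∈_; _⊆_)
open import Relation.Unary.Relation.Binary.Equality using (≐-setoid)

open import Algebra.Bundles using (CommutativeMonoid)
import Algebra.Construct.Pointwise as Pointwise
import Algebra.Properties.CommutativeSemigroup as CommutativeSemigroupProperties
import Algebra.Properties.Monoid.Mult as Mult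
open import Data.Bool.Base using (Bool; true; false; if_then_else_)
open import Data.Fin.Base using (Fin; zero; suc; combine; funToFin; finToFun; punchOut)
import Data.Fin.Properties as Finₚ
open import Data.Integer.Base as ℤ using (+_; +[1+_]; -[1+_])
import Data.Integer.Properties as ℤₚ
open import Data.List.Base as List using (List; []; _∷_; cartesianProductWith; concatMap; allFin; lookup)
open import Data.List.Membership.Propositional using () renaming (_∈_ to _∈ᴸ_)
open import Data.List.Membership.Propositional.Properties
  using (∈-cartesianProductWith⁺; ∈-concatMap⁺; ∈-allFin; ∈-tabulate⁺; ∈-++⁺ˡ; ∈-++⁺ʳ)
open import Data.List.Relation.Unary.Any as Any using (here; there; index)
import Data.List.Relation.Unary.Any.Properties as Anyₚ
open import Data.Nat.Base as ℕ using (zero; suc; _^_)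
import Data.Nat.Properties as ℕₚ
open import Data.Product.Base using (∃-syntax; _,_; proj₁; proj₂)
open import Data.Rational.Base as ℚ using (ℚ; mkℚ; 0ℚ; 1ℚ; ½; ∣_∣; toℚᵘ; positive; nonNegative; *<*)
import Data.Rational.Properties as ℚₚ
open import Data.Rational.Solver using (module +-*-Solver)
import Data.Rational.Unnormalised.Base as ℚᵘ
import Data.Rational.Unnormalised.Properties as ℚᵘₚ
open import Data.Sum.Base using (_⊎_; inj₁; inj₂)
open import Data.Vec.Functional as Vec using (Vector)
open import Function.Base using (_∘_; id)
open import Function.Bundles using (Func; Bijection)
open import Function.Definitions using (Injective)
open import Relation.Binary.Bundles using (Setoid)
open import Relation.Binary.PropositionalEquality as ≡ using (_≡_; _≢_; _≗_; refl; cong; subst; setoid)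
open import Relation.Nullary using (Dec; yes; no; contradiction)
open import Relation.Unary using (_≐_)
open import Relation.Unary.Properties using (≐-refl)
open +-*-Solver using (solve; _:=_; _:+_; _:*_; :-_; _:-_; con)

-- Gallai's theorem

module _ {a ℓ} (M : CommutativeMonoid a ℓ) where
  open CommutativeMonoid M
    renaming (Carrier to A; setoid to ≈-setoid; _∙_ to _+_; ε to 0#; ∙-cong to +-cong)
    hiding (refl; _≉_)
  open Mult monoid using (×-homo-+) renaming (_×_ to _·_)
  open CommutativeSemigroupProperties commutativeSemigroup using (interchange)

  Homothety : Set a
  Homothety = A × ℕ

  -- The pair (v , e) stands for the homothety with dilation factor e + 1.
  apply : Homothety → A → A
  apply (v , e) x = v + suc e · x

  translate : A → Homothety → Homothety
  translate u (v , e) = u + v , e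

  infixl 6 _⊕_
  -- The dilation factors d + 1 and e + 1 add up to (d + suc e) + 1. With natural numbers as
  -- factors, sums of homotheties make sense in any commutative monoid.
  _⊕_ : Homothety → Homothety → Homothety
  (u , d) ⊕ (v , e) = u + v , d ℕ.+ suc e

  apply-translate : ∀ u p x → apply (translate u p) x ≈ u + apply p x
  apply-translate u (v , e) x = assoc u v _

  apply-⊕ : ∀ p q x → apply (p ⊕ q) x ≈ apply p x + apply q x
  apply-⊕ (u , d) (v , e) x =
    trans (+-cong (CommutativeMonoid.refl M) (×-homo-+ x (suc d) (suc e))) (interchange u v _ _)

  Colouring : ℕ → Set _
  Colouring c = Func ≈-setoid (setoid (Fin c))

  infix 5 _⟨_⟩
  _⟨_⟩ : ∀ {c} → Colouring c → A → Fin c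
  χ ⟨ x ⟩ = Func.to χ x

  shift : ∀ {c} → A → Colouring c → Colouring c
  shift u χ = record
    { to = λ x → χ ⟨ u + x ⟩ ; cong = λ x≈y → Func.cong χ (+-cong (CommutativeMonoid.refl M) x≈y) }

  -- Product colouring: the tuple of colours of the points `x + y`, coded as one element of a finite
  -- set, so that a Gallai statement for more colours applies to it.
  shifts : ∀ {c} (Y : List A) → Colouring c → Colouring (c ^ List.length Y)
  shifts {c} Y χ = record
    { to   = λ x → funToFin (λ i → χ ⟨ x + lookup Y i ⟩)
    ; cong = λ x≈y → funToFin-cong (List.length Y) λ i → Func.cong χ (+-cong x≈y (CommutativeMonoid.refl M))
    }
    where
    funToFin-cong : ∀ m {f g : Fin m → Fin c} → (∀ i → f i ≡ g i) → funToFin f ≡ funToFin g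
    funToFin-cong zero    f≗g = refl
    funToFin-cong (suc m) f≗g = ≡.cong₂ combine (f≗g zero) (funToFin-cong m (f≗g ∘ suc))

  shifts-injective : ∀ {c} (Y : List A) (χ : Colouring c) {x x′ y} → y ∈ᴸ Y →
    shifts Y χ ⟨ x ⟩ ≡ shifts Y χ ⟨ x′ ⟩ → χ ⟨ x + y ⟩ ≡ χ ⟨ x′ + y ⟩
  shifts-injective Y χ {x} {x′} y∈Y eq rewrite Anyₚ.lookup-index y∈Y =
    ≡.trans (≡.sym (Finₚ.finToFun-funToFin (λ i → χ ⟨ x + lookup Y i ⟩) (index y∈Y)))
      (≡.trans (cong (λ f → finToFun f (index y∈Y)) eq)
        (Finₚ.finToFun-funToFin (λ i → χ ⟨ x′ + lookup Y i ⟩) (index y∈Y)))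

  -- Colour focusing

  MonoUnder : ∀ {c n} → Colouring c → Vector A (suc n) → Homothety → Set
  MonoUnder χ w p = ∀ i → χ ⟨ apply p (w i) ⟩ ≡ χ ⟨ apply p (w zero) ⟩

  shift-mono : ∀ {c n} {χ : Colouring c} {w : Vector A (suc n)} {u} p →
    MonoUnder (shift u χ) w p → MonoUnder χ w (translate u p)
  shift-mono {χ = χ} {w} {u} p mono i =
    ≡.trans (Func.cong χ (apply-translate u p (w i)))
      (≡.trans (mono i) (≡.sym (Func.cong χ (apply-translate u p (w zero)))))

  -- The first component is the focus, the common image of w zero under all the homotheties.
  Fan : ℕ → Set a
  Fan r = A × Vector Homothety r

  -- Each homothety of the fan already has a monochromatic copy, missing only the focus. Since
  -- `distinct` injects the members into the colours, a focused fan has at most `c` members.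
  record Focused {c n r} (χ : Colouring c) (w : Vector A (suc (suc n))) (F : Fan r) : Set ℓ where
    field
      focus    : ∀ j → apply (proj₂ F j) (w zero) ≈ proj₁ F
      mono     : ∀ j → MonoUnder χ (w ∘ suc) (proj₂ F j)
      distinct : Injective _≡_ _≡_ λ j → χ ⟨ apply (proj₂ F j) (w (suc zero)) ⟩

  -- The focus is the image of `w zero`, hence the one point missing from the monochromatic copy
  -- given by member `j`.
  focus-colour⇒mono : ∀ {c n r} {χ : Colouring c} {w : Vector A (suc (suc n))} {F : Fan r} →
    Focused χ w F → ∀ j → χ ⟨ proj₁ F ⟩ ≡ χ ⟨ apply (proj₂ F j) (w (suc zero)) ⟩ →
    MonoUnder χ w (proj₂ F j)
  focus-colour⇒mono foc j eq zero = refl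
  focus-colour⇒mono {χ = χ} foc j eq (suc i) =
    ≡.trans (Focused.mono foc j i)
      (≡.trans (≡.sym eq) (≡.sym (Func.cong χ (Focused.focus foc j))))

  -- The list comes before the colouring. This uniformity lets the induction form its product
  -- colouring in advance, and later lets one homothety be shared by many colourings.
  Gallai : ∀ {n} → Vector A (suc n) → Set _
  Gallai w = ∀ c → ∃[ L ] ∀ (χ : Colouring c) → ∃[ p ] p ∈ᴸ L × MonoUnder χ w p

  FanOrMono : ∀ {n} → Vector A (suc (suc n)) → ℕ → ℕ → Set _
  FanOrMono w c r = Σ (List (Fan r)) λ Fs → Σ (List Homothety) λ L → ∀ (χ : Colouring c) →
    (∃[ F ] F ∈ᴸ Fs × Focused χ w F) ⊎ (∃[ p ] p ∈ᴸ L × MonoUnder χ w p)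

  module _ {n} (w : Vector A (suc (suc n))) where
    points : ∀ {r} → Fan r → List A
    points (f , ps) = f ∷ cartesianProductWith (λ j i → apply (ps j) (w (suc i))) (allFin _) (allFin _)

    extend : ∀ {r} → Homothety → Fan r → Fan (suc r)
    extend p (f , ps) = apply p (w zero) + f , translate f p Vec.∷ λ j → p ⊕ ps j

    -- Every new member sends `w zero` to the new focus. By `same`, its other points can be
    -- recoloured with `p (w (suc zero))` in place of `p (w (suc i))`, which reduces them to the old
    -- fan, or to the old focus for the added member. `fresh` separates the colour of the added
    -- member from the others.
    extend-focused : ∀ {c r} {χ : Colouring c} (p : Homothety) (F : Fan r) →
      (∀ {y} → y ∈ᴸ points F → ∀ i →
        χ ⟨ apply p (w (suc i)) + y ⟩ ≡ χ ⟨ apply p (w (suc zero)) + y ⟩) →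
      Focused (shift (apply p (w (suc zero))) χ) w F →
      ¬ (∃[ j ] χ ⟨ apply p (w (suc zero)) + proj₁ F ⟩
              ≡ χ ⟨ apply p (w (suc zero)) + apply (proj₂ F j) (w (suc zero)) ⟩) →
      Focused χ w (extend p F)
    extend-focused {r = r} {χ} p F@(f , ps) same foc fresh = record
      { focus    = λ where
          zero    → trans (apply-translate f p _) (comm _ _)
          (suc j) → trans (apply-⊕ p (ps j) _) (+-cong (CommutativeMonoid.refl M) (Focused.focus foc j))
      ; mono     = λ j i → ≡.trans (colour j i) (≡.sym (colour j zero))
      ; distinct = λ {j} {j′} eq →
          distinct′ j j′ (≡.trans (≡.sym (colour j zero)) (≡.trans eq (colour j′ zero)))
      }
      where
      x₁ : A
      x₁ = apply p (w (suc zero))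

      colourOf : Fin (suc r) → Fin _
      colourOf zero    = χ ⟨ x₁ + f ⟩
      colourOf (suc j) = χ ⟨ x₁ + apply (ps j) (w (suc zero)) ⟩

      colour : ∀ j i → χ ⟨ apply (proj₂ (extend p F) j) (w (suc i)) ⟩ ≡ colourOf j
      colour zero    i = ≡.trans
        (Func.cong χ (trans (apply-translate f p _) (comm _ _)))
        (same (here refl) i)
      colour (suc j) i = ≡.trans (Func.cong χ (apply-⊕ p (ps j) _)) (≡.trans
        (same (there (∈-cartesianProductWith⁺ (λ j i → apply (ps j) (w (suc i)))
                        (∈-allFin j) (∈-allFin i))) i)
        (Focused.mono foc j i))

      distinct′ : ∀ j j′ → colourOf j ≡ colourOf j′ → j ≡ j′
      distinct′ zero    zero     eq = refl
      distinct′ zero    (suc j′) eq = contradiction (j′ , eq) fresh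
      distinct′ (suc j) zero     eq = contradiction (j , ≡.sym eq) fresh
      distinct′ (suc j) (suc j′) eq = cong suc (Focused.distinct foc eq)

    -- Colouring x by the colours of all x + y, with y a point of some fan, makes one homothety p
    -- monochromatic for all these translates at once; p then lengthens every fan by one.
    focusing : Gallai (w ∘ suc) → ∀ c r → FanOrMono w c r
    -- The empty fan is focused at any point.
    focusing ih c zero = (0# , λ ()) ∷ [] , [] , λ χ → inj₁
      (_ , here refl , record { focus = λ () ; mono = λ () ; distinct = λ { {()} } })
    focusing ih c (suc r) with focusing ih c r
    ... | Fs , L , find with ih (c ^ List.length (concatMap points Fs))
    ...   | L₀ , find₀ =
      cartesianProductWith extend L₀ Fs ,
      -- A full copy arises in two ways: it is already found for the shifted colouring, or it is a
      -- member of a fan whose focus shares its colour.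
      cartesianProductWith lift L₀ (L List.++ concatMap (List.tabulate ∘ proj₂) Fs) ,
      search
      where
      Y : List A
      Y = concatMap points Fs

      lift : Homothety → Homothety → Homothety
      lift p = translate (apply p (w (suc zero)))

      search : ∀ (χ : Colouring c) → _
      search χ with find₀ (shifts Y χ)
      ... | p , p∈L₀ , mono₀ with find (shift (apply p (w (suc zero))) χ)
      ...   | inj₂ (q , q∈L , mono) = inj₂
              (_ , ∈-cartesianProductWith⁺ lift p∈L₀ (∈-++⁺ˡ q∈L) , shift-mono {χ = χ} {w = w} q mono)
      ...   | inj₁ (F@(f , ps) , F∈Fs , foc)
        with Finₚ.any? (λ j → χ ⟨ apply p (w (suc zero)) + f ⟩
               Finₚ.≟ χ ⟨ apply p (w (suc zero)) + apply (ps j) (w (suc zero)) ⟩)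
      ...     | yes (j , eq) = inj₂
                (_ , ∈-cartesianProductWith⁺ lift p∈L₀
                       (∈-++⁺ʳ L (∈-concatMap⁺ (List.tabulate ∘ proj₂)
                         (Any.map (λ { refl → ∈-tabulate⁺ j }) F∈Fs)))
                   , shift-mono {χ = χ} {w = w} (ps j) (focus-colour⇒mono foc j eq))
      ...     | no fresh = inj₁
                (_ , ∈-cartesianProductWith⁺ extend p∈L₀ F∈Fs
                   , extend-focused p F
                       (λ y∈F i → shifts-injective Y χ
                         (∈-concatMap⁺ points (Any.map (λ { refl → y∈F }) F∈Fs)) (mono₀ i))
                       foc fresh)

  -- Induction on the number of points. A focused fan with `suc c` members would need `suc c`
  -- distinct colours, so the search must end in a monochromatic copy.
  gallai : ∀ n (w : Vector A (suc n)) → Gallai w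
  gallai zero    w c = (0# , 0) ∷ [] , λ χ → _ , here refl , λ { zero → refl }
  gallai (suc n) w c with focusing w (gallai n (w ∘ suc)) c (suc c)
  ... | Fs , L , find = L , search
    where
    search : ∀ (χ : Colouring c) → ∃[ p ] p ∈ᴸ L × MonoUnder χ w p
    search χ with find χ
    ... | inj₂ found = found
    ... | inj₁ (F , _ , foc)
      with Finₚ.pigeonhole (ℕₚ.n<1+n c) (λ j → χ ⟨ apply (proj₂ F j) (w (suc zero)) ⟩)
    ...   | j , j′ , j<j′ , eq = contradiction (Focused.distinct foc eq) (Finₚ.<⇒≢ j<j′)

-- The continuum

Cantor : Set
Cantor = ℕ → Bool

-- `x` fills the even positions and `y` the odd ones. This cuts the continuum into continuum many
-- disjoint rows, one for each `x`, each of size continuum.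
interleave : Cantor → Cantor → Cantor
interleave x y zero    = x zero
interleave x y (suc n) = interleave y (x ∘ suc) n

interleave-injective : ∀ {x x′ y y′} → interleave x y ≗ interleave x′ y′ → ∀ n → x n ≡ x′ n × y n ≡ y′ n
interleave-injective eq zero    = eq 0 , eq 1
interleave-injective {x} {x′} eq (suc n) =
  interleave-injective {x ∘ suc} {x′ ∘ suc} (λ i → eq (suc (suc i))) n

-- Untruncated excluded middle turns "for every x some y" into a choice function.
cantor-pigeonhole : ExcludedMiddle 0ℓ → ∀ m (h : Cantor → Fin m) →
  ∃[ i ] Σ (Cantor → Cantor) λ s → Injective _≗_ _≗_ s × (∀ x → h (s x) ≡ i)
cantor-pigeonhole em zero    h = contradiction (h λ _ → false) λ ()
-- Either some row misses colour `zero`, and the recursion goes on inside that row with one colour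
-- fewer, or every row meets it.
cantor-pigeonhole em (suc m) h with em {∃[ x ] ∀ y → zero ≢ h (interleave x y)}
... | yes (x , ≢zero) with cantor-pigeonhole em m (λ y → punchOut (≢zero y))
...   | i , s , s-inj , s-const =
  suc i , interleave x ∘ s ,
  (λ {y} {y′} eq → s-inj (λ n → proj₂ (interleave-injective {x} {x} eq n))) ,
  λ y → ≡.trans (≡.sym (Finₚ.punchIn-punchOut (≢zero (s y)))) (cong suc (s-const y))
-- Choose a point of colour `zero` from each row; points of different rows differ.
cantor-pigeonhole em (suc m) h | no ¬∃ =
  zero , (λ x → interleave x (proj₁ (hit x))) ,
  (λ {x} {x′} eq n → proj₁ (interleave-injective {x} {x′} eq n)) ,
  λ x → ≡.sym (proj₂ (hit x))
  where
  hit : ∀ x → ∃[ y ] zero ≡ h (interleave x y)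
  hit x with em {∃[ y ] zero ≡ h (interleave x y)}
  ... | yes hits = hits
  ... | no  none = contradiction (x , λ y eq → none (y , eq)) ¬∃

-- Arithmetic of rationals

0<½ : 0ℚ ℚ.< ½
0<½ = ℚₚ.positive⁻¹ ½

0<1 : 0ℚ ℚ.< 1ℚ
0<1 = ℚₚ.positive⁻¹ 1ℚ

⅓ : ℚ
⅓ = + 1 ℚ./ 3

0<⅓ : 0ℚ ℚ.< ⅓
0<⅓ = ℚₚ.positive⁻¹ ⅓

2ℚ : ℚ
2ℚ = 1ℚ ℚ.+ 1ℚ

≤-slack : ∀ {p q} r → 0ℚ ℚ.≤ r → p ℚ.+ r ≡ q → p ℚ.≤ q
≤-slack {p} r 0≤r refl = subst (ℚ._≤ p ℚ.+ r) (ℚₚ.+-identityʳ p) (ℚₚ.+-monoʳ-≤ p 0≤r)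

0≤-+ : ∀ {p q} → 0ℚ ℚ.≤ p → 0ℚ ℚ.≤ q → 0ℚ ℚ.≤ p ℚ.+ q
0≤-+ = ℚₚ.+-mono-≤

*-monoˡ-≤ : ∀ {r p q} → 0ℚ ℚ.≤ r → p ℚ.≤ q → r ℚ.* p ℚ.≤ r ℚ.* q
*-monoˡ-≤ {r} 0≤r = ℚₚ.*-monoˡ-≤-nonNeg r {{nonNegative 0≤r}}

*-monoʳ-≤ : ∀ {r p q} → 0ℚ ℚ.≤ r → p ℚ.≤ q → p ℚ.* r ℚ.≤ q ℚ.* r
*-monoʳ-≤ {r} 0≤r = ℚₚ.*-monoʳ-≤-nonNeg r {{nonNegative 0≤r}}

0<-* : ∀ {p q} → 0ℚ ℚ.< p → 0ℚ ℚ.< q → 0ℚ ℚ.< p ℚ.* q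
0<-* {p} {q} 0<p 0<q = ℚₚ.positive⁻¹ _ {{ℚₚ.pos*pos⇒pos p {{positive 0<p}} q {{positive 0<q}}}}

0≤-* : ∀ {p q} → 0ℚ ℚ.≤ p → 0ℚ ℚ.≤ q → 0ℚ ℚ.≤ p ℚ.* q
0≤-* {p} {q} 0≤p 0≤q = subst (ℚ._≤ p ℚ.* q) (ℚₚ.*-zeroʳ p) (*-monoˡ-≤ 0≤p 0≤q)

1≤⇒0≤ : ∀ {p} → 1ℚ ℚ.≤ p → 0ℚ ℚ.≤ p
1≤⇒0≤ = ℚₚ.≤-trans (ℚₚ.<⇒≤ 0<1)

1≤-* : ∀ {p q} → 1ℚ ℚ.≤ p → 1ℚ ℚ.≤ q → 1ℚ ℚ.≤ p ℚ.* q
1≤-* {p} {q} 1≤p 1≤q = ℚₚ.≤-trans 1≤p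
  (subst (ℚ._≤ p ℚ.* q) (ℚₚ.*-identityʳ p) (*-monoˡ-≤ (1≤⇒0≤ 1≤p) 1≤q))

∣-∣-sym : ∀ p q → ∣ p ℚ.- q ∣ ≡ ∣ q ℚ.- p ∣
∣-∣-sym p q = ≡.trans
  (cong ∣_∣ (solve 2 (λ a b → a :- b := :- (b :- a)) refl p q)) (ℚₚ.∣-p∣≡∣p∣ (q ℚ.- p))

∣∣-≤ : ∀ {p r} → p ℚ.≤ r → 0ℚ ℚ.≤ r ℚ.+ p → ∣ p ∣ ℚ.≤ r
∣∣-≤ {p} {r} p≤r 0≤r+p with ℚₚ.∣p∣≡p∨∣p∣≡-p p
... | inj₁ eq = subst (ℚ._≤ r) (≡.sym eq) p≤r
... | inj₂ eq = subst (ℚ._≤ r) (≡.sym eq)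
  (≤-slack (r ℚ.+ p) 0≤r+p (solve 2 (λ p r → :- p :+ (r :+ p) := r) refl p r))

≤-∣∣ : ∀ p → p ℚ.≤ ∣ p ∣
≤-∣∣ p with ℚₚ.≤-total 0ℚ p
... | inj₁ 0≤p = ℚₚ.≤-reflexive (≡.sym (ℚₚ.0≤p⇒∣p∣≡p 0≤p))
... | inj₂ p≤0 = ℚₚ.≤-trans p≤0 (ℚₚ.0≤∣p∣ p)

-- Archimedean property

ι : ℕ → ℚ
ι zero    = 0ℚ
ι (suc n) = 1ℚ ℚ.+ ι n

0≤ι : ∀ n → 0ℚ ℚ.≤ ι n
0≤ι zero    = ℚₚ.≤-refl
0≤ι (suc n) = 0≤-+ (ℚₚ.<⇒≤ 0<1) (0≤ι n)

1≤ι : ∀ n → 1ℚ ℚ.≤ ι (suc n)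
1≤ι n = ≤-slack (ι n) (0≤ι n) refl

-- Unnormalised fractions need no reduction to lowest terms, so comparisons become integer
-- inequalities by cross-multiplication.
toℚᵘ-ι : ∀ n → toℚᵘ (ι n) ℚᵘ.≃ ℚᵘ.mkℚᵘ (+ n) 0
toℚᵘ-ι zero    = ℚᵘₚ.≃-refl
toℚᵘ-ι (suc n) = ℚᵘₚ.≃-trans (ℚₚ.toℚᵘ-homo-+ 1ℚ (ι n))
  (ℚᵘₚ.≃-trans (ℚᵘₚ.+-congʳ ℚᵘ.1ℚᵘ (toℚᵘ-ι n))
    (ℚᵘ.*≡* (cong (λ i → (+ 1 ℤ.+ i) ℤ.* + 1) (ℤₚ.*-identityʳ (+ n)))))

archimedean : ∀ ε → 0ℚ ℚ.< ε → ∃[ n ] 1ℚ ℚ.< ι n ℚ.* ε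
archimedean (mkℚ (+ 0)     d _) (*<* (ℤ.+<+ ()))
archimedean (mkℚ -[1+ _ ] d _) (*<* ())
-- Here ε = (p + 1) / (d + 1), so the multiple d + 2 already exceeds 1.
archimedean ε@(mkℚ +[1+ p ] d _) _ = suc (suc d) , ℚₚ.toℚᵘ-cancel-<
  (ℚᵘₚ.<-respʳ-≃
    (ℚᵘₚ.≃-sym (ℚᵘₚ.≃-trans (ℚₚ.toℚᵘ-homo-* (ι (suc (suc d))) ε)
      (ℚᵘₚ.*-congʳ {toℚᵘ ε} (toℚᵘ-ι (suc (suc d))))))
    (ℚᵘ.*<* (ℤ.+<+ lt)))
  where
  lt : 1 ℕ.* suc (d ℕ.+ 0) ℕ.< (suc (suc d) ℕ.* suc p) ℕ.* 1
  lt = begin-strict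
    1 ℕ.* suc (d ℕ.+ 0)             ≡⟨ ≡.trans (ℕₚ.*-identityˡ _) (cong suc (ℕₚ.+-identityʳ d)) ⟩
    suc d                           <⟨ ℕₚ.n<1+n (suc d) ⟩
    suc (suc d)                     ≤⟨ ℕₚ.m≤m*n (suc (suc d)) (suc p) ⟩
    suc (suc d) ℕ.* suc p           ≡⟨ ℕₚ.*-identityʳ _ ⟨
    (suc (suc d) ℕ.* suc p) ℕ.* 1   ∎
    where open ℕₚ.≤-Reasoning

-- Powers of one third

⅓^_ : ℕ → ℚ
⅓^ zero  = 1ℚ
⅓^ suc n = ⅓ ℚ.* ⅓^ n

0≤⅓^ : ∀ n → 0ℚ ℚ.≤ ⅓^ n
0≤⅓^ zero    = ℚₚ.<⇒≤ 0<1
0≤⅓^ (suc n) = 0≤-* (ℚₚ.<⇒≤ 0<⅓) (0≤⅓^ n)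

⅓^-≤1 : ∀ n → ⅓^ n ℚ.≤ 1ℚ
⅓^-≤1 zero    = ℚₚ.≤-refl
⅓^-≤1 (suc n) = ℚₚ.≤-trans (*-monoˡ-≤ (ℚₚ.<⇒≤ 0<⅓) (⅓^-≤1 n))
  (≤-slack (⅓ ℚ.+ ⅓) (0≤-+ (ℚₚ.<⇒≤ 0<⅓) (ℚₚ.<⇒≤ 0<⅓)) refl)

-- A crude comparison of linear with geometric growth; it reduces the smallness of `⅓^ n` to the
-- Archimedean property.
ι*⅓^-≤1 : ∀ n → ι n ℚ.* ⅓^ n ℚ.≤ 1ℚ
ι*⅓^-≤1 zero    = ℚₚ.<⇒≤ 0<1
ι*⅓^-≤1 (suc n) = begin
  ι (suc n) ℚ.* ⅓^ suc n                    ≡⟨ solve 3 (λ i t x → (con 1ℚ :+ i) :* (t :* x) := t :* x :+ t :* (i :* x))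
                                                 refl (ι n) ⅓ (⅓^ n) ⟩
  ⅓ ℚ.* ⅓^ n ℚ.+ ⅓ ℚ.* (ι n ℚ.* ⅓^ n)       ≤⟨ ℚₚ.+-mono-≤ (*-monoˡ-≤ (ℚₚ.<⇒≤ 0<⅓) (⅓^-≤1 n))
                                                           (*-monoˡ-≤ (ℚₚ.<⇒≤ 0<⅓) (ι*⅓^-≤1 n)) ⟩
  ⅓ ℚ.* 1ℚ ℚ.+ ⅓ ℚ.* 1ℚ                     ≤⟨ ≤-slack ⅓ (ℚₚ.<⇒≤ 0<⅓) refl ⟩
  1ℚ                                        ∎
  where open ℚₚ.≤-Reasoning

⅓^-small : ∀ ε → 0ℚ ℚ.< ε → ∃[ n ] ⅓^ n ℚ.< ε
⅓^-small ε 0<ε with archimedean ε 0<ε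
... | n , 1<ιnε = n , ℚₚ.*-cancelˡ-<-nonNeg (ι n) {{nonNegative (0≤ι n)}} (ℚₚ.≤-<-trans (ι*⅓^-≤1 n) 1<ιnε)

-- The Cantor set

digit : Bool → ℚ
digit b = if b then 2ℚ else 0ℚ

-- Partial sums of the ternary expansion with digits 0 and 2, in Horner form: the recursion follows
-- the self-similarity of the Cantor set.
partial : Cantor → ℕ → ℚ
partial b zero    = 0ℚ
partial b (suc n) = ⅓ ℚ.* (digit (b 0) ℚ.+ partial (b ∘ suc) n)

0≤digit : ∀ b → 0ℚ ℚ.≤ digit b
0≤digit true  = ℚₚ.nonNegative⁻¹ 2ℚ
0≤digit false = ℚₚ.≤-refl

digit≤2 : ∀ b → digit b ℚ.≤ 2ℚ
digit≤2 true  = ℚₚ.≤-refl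
digit≤2 false = ℚₚ.nonNegative⁻¹ 2ℚ

0≤partial : ∀ b n → 0ℚ ℚ.≤ partial b n
0≤partial b zero    = ℚₚ.≤-refl
0≤partial b (suc n) = 0≤-* (ℚₚ.<⇒≤ 0<⅓) (0≤-+ (0≤digit (b 0)) (0≤partial (b ∘ suc) n))

partial≤1 : ∀ b n → partial b n ℚ.≤ 1ℚ
partial≤1 b zero    = ℚₚ.<⇒≤ 0<1
partial≤1 b (suc n) = *-monoˡ-≤ (ℚₚ.<⇒≤ 0<⅓) (ℚₚ.+-mono-≤ (digit≤2 (b 0)) (partial≤1 (b ∘ suc) n))

unit-distance : ∀ {p q} → 0ℚ ℚ.≤ p → p ℚ.≤ 1ℚ → 0ℚ ℚ.≤ q → q ℚ.≤ 1ℚ → ∣ p ℚ.- q ∣ ℚ.≤ 1ℚ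
unit-distance {p} {q} 0≤p p≤1 0≤q q≤1 = ∣∣-≤
  (ℚₚ.≤-trans (≤-slack q 0≤q (solve 2 (λ p q → p :- q :+ q := p) refl p q)) p≤1)
  (ℚₚ.≤-trans (0≤-+ 0≤p (ℚₚ.≤-trans (ℚₚ.≤-reflexive (≡.sym (ℚₚ.+-inverseʳ q))) (ℚₚ.+-monoˡ-≤ (ℚ.- q) q≤1)))
    (ℚₚ.≤-reflexive (solve 2 (λ p q → p :+ (con 1ℚ :- q) := con 1ℚ :+ (p :- q)) refl p q)))

partial-distance : ∀ b c m n → ∣ partial b m ℚ.- partial c n ∣ ℚ.≤ 1ℚ
partial-distance b c m n = unit-distance (0≤partial b m) (partial≤1 b m) (0≤partial c n) (partial≤1 c n)

∣*∣-nonNeg : ∀ {r} → 0ℚ ℚ.≤ r → ∀ p → ∣ r ℚ.* p ∣ ≡ r ℚ.* ∣ p ∣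
∣*∣-nonNeg {r} 0≤r p = ≡.trans (ℚₚ.∣p*q∣≡∣p∣*∣q∣ r p) (cong (ℚ._* ∣ p ∣) (ℚₚ.0≤p⇒∣p∣≡p 0≤r))

partial-tails : ∀ d p q → ∣ ⅓ ℚ.* (d ℚ.+ p) ℚ.- ⅓ ℚ.* (d ℚ.+ q) ∣ ≡ ⅓ ℚ.* ∣ p ℚ.- q ∣
partial-tails d p q = ≡.trans
  (cong ∣_∣ (solve 4 (λ t d p q → t :* (d :+ p) :- t :* (d :+ q) := t :* (p :- q)) refl ⅓ d p q))
  (∣*∣-nonNeg (ℚₚ.<⇒≤ 0<⅓) (p ℚ.- q))

-- Both sums share their leading digit, so dropping it multiplies the distance by three; after `N`
-- digits the bound 1 remains.
partial-cauchy : ∀ N b {m n} → N ℕ.≤ m → N ℕ.≤ n → ∣ partial b m ℚ.- partial b n ∣ ℚ.≤ ⅓^ N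
partial-cauchy zero    b {m} {n} _ _ = partial-distance b b m n
partial-cauchy (suc N) b {suc m} {suc n} (ℕ.s≤s N≤m) (ℕ.s≤s N≤n) =
  subst (ℚ._≤ ⅓^ suc N) (≡.sym (partial-tails (digit (b 0)) (partial (b ∘ suc) m) (partial (b ∘ suc) n)))
    (*-monoˡ-≤ (ℚₚ.<⇒≤ 0<⅓) (partial-cauchy N (b ∘ suc) N≤m N≤n))

cantor : Cantor → ℝ
cantor b = mkℝ (partial b) λ ε 0<ε → let N , small = ⅓^-small ε 0<ε in
  N , λ m n N≤m N≤n → ℚₚ.≤-<-trans (partial-cauchy N b N≤m N≤n) small

constᴿ : ℚ → ℝ
constᴿ q = mkℝ (λ _ → q) λ ε 0<ε → 0 , λ _ _ _ _ → subst (λ t → ∣ t ∣ ℚ.< ε) (≡.sym (ℚₚ.+-inverseʳ q)) 0<ε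

-- Equality of reals

-- Implicit real arguments are given explicitly below: left to unification, they make Agda unfold
-- the Cauchy proofs inside the arithmetic operations.

scale : ∀ B ε → 0ℚ ℚ.< B → 0ℚ ℚ.< ε → ∃[ δ ] (0ℚ ℚ.< δ × B ℚ.* δ ≡ ε)
scale B ε 0<B 0<ε = (ℚ.1/ B) ℚ.* ε ,
  0<-* (ℚₚ.positive⁻¹ (ℚ.1/ B) {{ℚₚ.1/pos⇒pos B}}) 0<ε ,
  ≡.trans (≡.sym (ℚₚ.*-assoc B (ℚ.1/ B) ε)) (≡.trans (cong (ℚ._* ε) (ℚₚ.*-inverseʳ B)) (ℚₚ.*-identityˡ ε))
  where
  instance
    pos : ℚ.Positive B
    pos = positive 0<B
    nz : ℚ.NonZero B
    nz = ℚₚ.pos⇒nonZero B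

-- The reindexing `φ` serves sequences that run ahead of each other, such as a Cantor point and its
-- tail.
≈ᴿ-lipschitz : ∀ {x y u v} B → 0ℚ ℚ.< B → (φ : ℕ → ℕ) → (∀ n → n ℕ.≤ φ n) →
  (∀ n → ∣ seq x n ℚ.- seq y n ∣ ℚ.≤ B ℚ.* ∣ seq u (φ n) ℚ.- seq v (φ n) ∣) → u ≈ᴿ v → x ≈ᴿ y
≈ᴿ-lipschitz B 0<B φ n≤φn bound u≈v ε 0<ε with scale B ε 0<B 0<ε
... | δ , 0<δ , refl with u≈v δ 0<δ
...   | N , close = N , λ n N≤n → ℚₚ.≤-<-trans (bound n)
  (ℚₚ.*-monoʳ-<-pos B {{positive 0<B}} (close (φ n) (ℕₚ.≤-trans N≤n (n≤φn n))))

≈ᴿ-contract : ∀ {x y u v} →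
  (∀ n → ∣ seq x n ℚ.- seq y n ∣ ℚ.≤ ∣ seq u n ℚ.- seq v n ∣) → u ≈ᴿ v → x ≈ᴿ y
≈ᴿ-contract {x} {y} {u} {v} bound = ≈ᴿ-lipschitz {x} {y} {u} {v} 1ℚ 0<1 id (λ _ → ℕₚ.≤-refl)
  λ n → subst (∣ seq x n ℚ.- seq y n ∣ ℚ.≤_) (≡.sym (ℚₚ.*-identityˡ _)) (bound n)

module ℝ-eq = Setoid ℝ-setoid

seq-≡⇒≈ᴿ : ∀ {x y} → seq x ≗ seq y → x ≈ᴿ y
seq-≡⇒≈ᴿ {x} {y} eq ε 0<ε = 0 , λ n _ →
  subst (λ t → ∣ t ∣ ℚ.< ε) (≡.sym (≡.trans (cong (ℚ._- seq y n) (eq n)) (ℚₚ.+-inverseʳ (seq y n)))) 0<ε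

+ᴿ-congˡ : ∀ x {y z} → y ≈ᴿ z → x +ᴿ y ≈ᴿ x +ᴿ z
+ᴿ-congˡ x {y} {z} = ≈ᴿ-contract {x +ᴿ y} {x +ᴿ z} {y} {z} λ n → ℚₚ.≤-reflexive (cong ∣_∣
  (solve 3 (λ x y z → x :+ y :- (x :+ z) := y :- z) refl (seq x n) (seq y n) (seq z n)))

+ᴿ-congʳ : ∀ x {y z} → y ≈ᴿ z → y +ᴿ x ≈ᴿ z +ᴿ x
+ᴿ-congʳ x {y} {z} = ≈ᴿ-contract {y +ᴿ x} {z +ᴿ x} {y} {z} λ n → ℚₚ.≤-reflexive (cong ∣_∣
  (solve 3 (λ x y z → y :+ x :- (z :+ x) := y :- z) refl (seq x n) (seq y n) (seq z n)))

+ᴿ-cong : ∀ {x x′ y y′} → x ≈ᴿ x′ → y ≈ᴿ y′ → x +ᴿ y ≈ᴿ x′ +ᴿ y′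
+ᴿ-cong {x} {x′} {y} {y′} x≈x′ y≈y′ =
  ℝ-eq.trans {x +ᴿ y} {x′ +ᴿ y} {x′ +ᴿ y′} (+ᴿ-congʳ y {x} {x′} x≈x′) (+ᴿ-congˡ x′ {y} {y′} y≈y′)

*ᴿ-congˡ : ∀ x {y z} → y ≈ᴿ z → x *ᴿ y ≈ᴿ x *ᴿ z
*ᴿ-congˡ x {y} {z} y≈z with cauchy-bounded (seq x) (cauchy x)
... | B , 0<B , x≤B = ≈ᴿ-lipschitz {x *ᴿ y} {x *ᴿ z} {y} {z} B 0<B id (λ _ → ℕₚ.≤-refl) bound y≈z
  where
  bound : ∀ n → ∣ seq x n ℚ.* seq y n ℚ.- seq x n ℚ.* seq z n ∣ ℚ.≤ B ℚ.* ∣ seq y n ℚ.- seq z n ∣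
  bound n = subst (ℚ._≤ B ℚ.* ∣ seq y n ℚ.- seq z n ∣)
    (≡.sym (≡.trans
      (cong ∣_∣ (solve 3 (λ x y z → x :* y :- x :* z := x :* (y :- z)) refl (seq x n) (seq y n) (seq z n)))
      (ℚₚ.∣p*q∣≡∣p∣*∣q∣ (seq x n) (seq y n ℚ.- seq z n))))
    (*-monoʳ-≤ (ℚₚ.0≤∣p∣ _) (x≤B n))

*ᴿ-comm : ∀ x y → x *ᴿ y ≈ᴿ y *ᴿ x
*ᴿ-comm x y = seq-≡⇒≈ᴿ {x *ᴿ y} {y *ᴿ x} λ n → ℚₚ.*-comm (seq x n) (seq y n)

*ᴿ-congʳ : ∀ x {y z} → y ≈ᴿ z → y *ᴿ x ≈ᴿ z *ᴿ x
*ᴿ-congʳ x {y} {z} y≈z = ℝ-eq.trans {y *ᴿ x} {x *ᴿ y} {z *ᴿ x} (*ᴿ-comm y x)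
  (ℝ-eq.trans {x *ᴿ y} {x *ᴿ z} {z *ᴿ x} (*ᴿ-congˡ x {y} {z} y≈z) (*ᴿ-comm x z))

-- Equal first digits cancel: the distance of the tails is three times the distance of the points
-- one index later.
cantor-tail : ∀ {b c} → b 0 ≡ c 0 → cantor b ≈ᴿ cantor c → cantor (b ∘ suc) ≈ᴿ cantor (c ∘ suc)
cantor-tail {b} {c} b₀≡c₀ = ≈ᴿ-lipschitz {cantor (b ∘ suc)} {cantor (c ∘ suc)} {cantor b} {cantor c}
  (ι 3) (ℚₚ.positive⁻¹ (ι 3)) suc ℕₚ.n≤1+n
  λ n → ℚₚ.≤-reflexive (≡.sym (≡.trans
    (cong (λ d → ι 3 ℚ.* ∣ partial b (suc n) ℚ.- ⅓ ℚ.* (digit d ℚ.+ partial (c ∘ suc) n) ∣) (≡.sym b₀≡c₀))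
    (≡.trans
      (cong (ι 3 ℚ.*_) (partial-tails (digit (b 0)) (partial (b ∘ suc) n) (partial (c ∘ suc) n)))
      (solve 1 (λ t → con (ι 3) :* (con ⅓ :* t) := t) refl _))))

-- The removed middle third: the first point is at least 2/3 and the second at most 1/3.
head-gap : ∀ b c → b 0 ≡ true → c 0 ≡ false → ∀ n → ⅓ ℚ.≤ partial b (suc n) ℚ.- partial c (suc n)
head-gap b c b₀ c₀ n rewrite b₀ | c₀ = ≤-slack (⅓ ℚ.* (p ℚ.+ (1ℚ ℚ.- q)))
  (0≤-* (ℚₚ.<⇒≤ 0<⅓) (0≤-+ (0≤partial (b ∘ suc) n)
    (ℚₚ.≤-trans (ℚₚ.≤-reflexive (≡.sym (ℚₚ.+-inverseʳ q))) (ℚₚ.+-monoˡ-≤ (ℚ.- q) (partial≤1 (c ∘ suc) n)))))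
  (solve 2 (λ p q → con ⅓ :+ con ⅓ :* (p :+ (con 1ℚ :- q)) := con ⅓ :* (con 2ℚ :+ p) :- con ⅓ :* (con 0ℚ :+ q)) refl p q)
  where
  p = partial (b ∘ suc) n
  q = partial (c ∘ suc) n

head-≢ : ∀ b c → b 0 ≡ true → c 0 ≡ false → ¬ (cantor b ≈ᴿ cantor c)
head-≢ b c b₀ c₀ b≈c with b≈c ⅓ 0<⅓
... | N , close = ℚₚ.<-irrefl refl (ℚₚ.<-≤-trans (close (suc N) (ℕₚ.n≤1+n N)) (ℚₚ.≤-trans (head-gap b c b₀ c₀ N) (≤-∣∣ _)))

cantor-head : ∀ {b c} → cantor b ≈ᴿ cantor c → b 0 ≡ c 0
cantor-head {b} {c} b≈c with b 0 in b₀ | c 0 in c₀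
... | true  | true  = refl
... | false | false = refl
... | true  | false = contradiction b≈c (head-≢ b c b₀ c₀)
... | false | true  = contradiction (ℝ-eq.sym {cantor b} {cantor c} b≈c) (head-≢ c b c₀ b₀)

cantor-injective : ∀ {b c} → cantor b ≈ᴿ cantor c → b ≗ c
cantor-injective {b} {c} b≈c zero    = cantor-head {b} {c} b≈c
cantor-injective {b} {c} b≈c (suc n) =
  cantor-injective {b ∘ suc} {c ∘ suc} (cantor-tail {b} {c} (cantor-head {b} {c} b≈c) b≈c) n

-- Separation

Apart : ℚ → ℝ → ℝ → Set
Apart δ x y = ∃[ N ] ∀ n → N ℕ.≤ n → δ ℚ.≤ ∣ seq x n ℚ.- seq y n ∣

Apart-mono : ∀ {δ ε x y} → δ ℚ.≤ ε → Apart ε x y → Apart δ x y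
Apart-mono δ≤ε (N , far) = N , λ n N≤n → ℚₚ.≤-trans δ≤ε (far n N≤n)

module _ (em : ExcludedMiddle 0ℓ) where

  -- If no gap δ works, the sequences come within δ of each other beyond their Cauchy moduli; one
  -- such index controls all later ones up to 3 δ.
  ≉⇒Apart : ∀ {x y} → ¬ (x ≈ᴿ y) → ∃[ δ ] (0ℚ ℚ.< δ × Apart δ x y)
  ≉⇒Apart {x} {y} x≉y with em {∃[ δ ] (0ℚ ℚ.< δ × Apart δ x y)}
  ... | yes apart = apart
  ... | no ¬apart = contradiction x≈y x≉y
    where
    x≈y : x ≈ᴿ y
    x≈y ε 0<ε with scale (ι 3) ε (ℚₚ.positive⁻¹ (ι 3)) 0<ε
    ... | δ , 0<δ , refl with cauchy x δ 0<δ | cauchy y δ 0<δ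
    ... | M , cx | N , cy with em {∃[ n ] (M ℕ.⊔ N ℕ.≤ n × ∣ seq x n ℚ.- seq y n ∣ ℚ.< δ)}
    ... | no ¬close = contradiction
            (δ , 0<δ , M ℕ.⊔ N , λ n ≤n → ℚₚ.≮⇒≥ λ lt → ¬close (n , ≤n , lt)) ¬apart
    ... | yes (n , ≤n , xₙ~yₙ) = M ℕ.⊔ N , λ m ≤m → begin-strict
      ∣ seq x m ℚ.- seq y m ∣
        ≡⟨ cong ∣_∣ (solve 4 (λ a b c d → a :- d := (a :- b) :+ ((b :- c) :+ (c :- d))) refl
             (seq x m) (seq x n) (seq y n) (seq y m)) ⟩
      ∣ (seq x m ℚ.- seq x n) ℚ.+ ((seq x n ℚ.- seq y n) ℚ.+ (seq y n ℚ.- seq y m)) ∣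
        ≤⟨ ℚₚ.≤-trans (ℚₚ.∣p+q∣≤∣p∣+∣q∣ (seq x m ℚ.- seq x n) _)
             (ℚₚ.+-monoʳ-≤ ∣ seq x m ℚ.- seq x n ∣ (ℚₚ.∣p+q∣≤∣p∣+∣q∣ (seq x n ℚ.- seq y n) (seq y n ℚ.- seq y m))) ⟩
      ∣ seq x m ℚ.- seq x n ∣ ℚ.+ (∣ seq x n ℚ.- seq y n ∣ ℚ.+ ∣ seq y n ℚ.- seq y m ∣)
        <⟨ ℚₚ.+-mono-< (cx m n (ℕₚ.m⊔n≤o⇒m≤o M N ≤m) (ℕₚ.m⊔n≤o⇒m≤o M N ≤n))
             (ℚₚ.+-mono-< xₙ~yₙ (cy n m (ℕₚ.m⊔n≤o⇒n≤o M N ≤n) (ℕₚ.m⊔n≤o⇒n≤o M N ≤m))) ⟩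
      δ ℚ.+ (δ ℚ.+ δ)
        ≡⟨ solve 1 (λ d → d :+ (d :+ d) := con (ι 3) :* d) refl δ ⟩
      ι 3 ℚ.* δ ∎
      where open ℚₚ.≤-Reasoning

-- Take the minimum; `down` says that each condition survives shrinking the constant.
uniform-δ : ∀ {n} (Q : Fin n → ℚ → Set) → (∀ i {δ ε} → δ ℚ.≤ ε → Q i ε → Q i δ) →
  (∀ i → ∃[ δ ] (0ℚ ℚ.< δ × Q i δ)) → ∃[ δ ] (0ℚ ℚ.< δ × ∀ i → Q i δ)
uniform-δ {zero}  Q down ex = 1ℚ , 0<1 , λ ()
uniform-δ {suc n} Q down ex with ex zero | uniform-δ (Q ∘ suc) (down ∘ suc) (ex ∘ suc)
... | δ , 0<δ , q₀ | ε , 0<ε , q = δ ℚ.⊓ ε , ⊓-pos , λ where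
    zero    → down zero (ℚₚ.p⊓q≤p δ ε) q₀
    (suc i) → down (suc i) (ℚₚ.p⊓q≤q δ ε) (q i)
  where
  ⊓-pos : 0ℚ ℚ.< δ ℚ.⊓ ε
  ⊓-pos with ℚₚ.⊓-sel δ ε
  ... | inj₁ eq = subst (0ℚ ℚ.<_) (≡.sym eq) 0<δ
  ... | inj₂ eq = subst (0ℚ ℚ.<_) (≡.sym eq) 0<ε

-- Homothetic copies

module 𝔼-eq {k} = Setoid (𝔼-setoid k)

-- Euclidean space as a commutative monoid

ℝ-+-commutativeMonoid : CommutativeMonoid 0ℓ 0ℓ
ℝ-+-commutativeMonoid = record
  { Carrier = ℝ ; _≈_ = _≈ᴿ_ ; _∙_ = _+ᴿ_ ; ε = 0ᴿ
  ; isCommutativeMonoid = record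
    { isMonoid = record
      { isSemigroup = record
        { isMagma = record
          { isEquivalence = ℝ-eq.isEquivalence
          ; ∙-cong = λ {x} {x′} {y} {y′} → +ᴿ-cong {x} {x′} {y} {y′} }
        ; assoc = λ x y z → seq-≡⇒≈ᴿ {(x +ᴿ y) +ᴿ z} {x +ᴿ (y +ᴿ z)}
            λ n → ℚₚ.+-assoc (seq x n) (seq y n) (seq z n) }
      ; identity = (λ x → seq-≡⇒≈ᴿ {0ᴿ +ᴿ x} {x} λ n → ℚₚ.+-identityˡ (seq x n))
                 , (λ x → seq-≡⇒≈ᴿ {x +ᴿ 0ᴿ} {x} λ n → ℚₚ.+-identityʳ (seq x n)) }
    ; comm = λ x y → seq-≡⇒≈ᴿ {x +ᴿ y} {y +ᴿ x} λ n → ℚₚ.+-comm (seq x n) (seq y n)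
    }
  }

𝔼-+-commutativeMonoid : ℕ → CommutativeMonoid 0ℓ 0ℓ
𝔼-+-commutativeMonoid k = record
  { isCommutativeMonoid = Pointwise.isCommutativeMonoid (Fin k)
      (CommutativeMonoid.isCommutativeMonoid ℝ-+-commutativeMonoid) }

-- Connects the monoid multiples in Gallai's theorem with multiplication by a real number.
seq-× : ∀ {k} m (x : 𝔼 k) l n → seq (Mult._×_ (CommutativeMonoid.monoid (𝔼-+-commutativeMonoid k)) m x l) n ≡ ι m ℚ.* seq (x l) n
seq-× zero    x l n = ≡.sym (ℚₚ.*-zeroˡ (seq (x l) n))
seq-× (suc m) x l n = ≡.trans (cong (seq (x l) n ℚ.+_) (seq-× m x l n))
  (solve 2 (λ x i → x :+ i :* x := (con 1ℚ :+ i) :* x) refl (seq (x l) n) (ι m))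

affine : ∀ {k} → 𝔼 k → ℝ → 𝔼 k → 𝔼 k
affine a r x = a +ᴱ r ·ᴱ x

affine-cong : ∀ {k} (a : 𝔼 k) r {x y} → x ≈ᴱ y → affine a r x ≈ᴱ affine a r y
affine-cong a r {x} {y} x≈y l =
  +ᴿ-congˡ (a l) {r *ᴿ x l} {r *ᴿ y l} (*ᴿ-congˡ r {x l} {y l} (x≈y l))

affine-congʳ : ∀ {k} (a : 𝔼 k) {r s} x → r ≈ᴿ s → affine a r x ≈ᴱ affine a s x
affine-congʳ a {r} {s} x r≈s l =
  +ᴿ-congˡ (a l) {r *ᴿ x l} {s *ᴿ x l} (*ᴿ-congʳ (x l) {r} {s} r≈s)

+[]-congʳ : ∀ {k} (a : 𝔼 k) {r s} (S : Pred (𝔼 k) 0ℓ) → r ≈ᴿ s → a +[ r ] S ⊆ a +[ s ] S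
+[]-congʳ a {r} {s} S r≈s {y} (x , x∈S , y≈) = x , x∈S ,
  𝔼-eq.trans {_} {y} {affine a r x} {affine a s x} y≈ (affine-congʳ a {r} {s} x r≈s)

Image : ∀ {a} (A : Setoid a 0ℓ) → (Cantor → Setoid.Carrier A) → Pred (Setoid.Carrier A) 0ℓ
Image A g x = ∃[ b ] Setoid._≈_ A x (g b)

-- The maps `g` come from choice functions and need not visibly respect pointwise equality;
-- extensionality turns `b ≗ c` into an identity.
image-cardinality : Extensionality 0ℓ 0ℓ → ∀ {a} (A : Setoid a 0ℓ) (g : Cantor → Setoid.Carrier A) →
  Injective _≗_ (Setoid._≈_ A) g → HasCardinalityOf continuum A (Image A g)
image-cardinality ext A g g-inj = record
  { to        = λ b → g b , b , Setoid.refl A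
  ; cong      = g-cong
  ; bijective = g-inj , λ (x , b , x≈gb) → b , λ c≗b → Setoid.trans A (g-cong c≗b) (Setoid.sym A x≈gb)
  }
  where
  g-cong : ∀ {b c} → b ≗ c → Setoid._≈_ A (g b) (g c)
  g-cong b≗c with ext b≗c
  ... | refl = Setoid.refl A

Separated : ∀ {n k} → ℚ → (Fin n → 𝔼 k) → Set
Separated δ σ = ∀ i j → i ≢ j → ∃[ l ] Apart δ (σ i l) (σ j l)

separation : ExcludedMiddle 0ℓ → ∀ {n k} (σ : Fin n → 𝔼 k) → Injective _≡_ _≈ᴱ_ σ →
  ∃[ δ ] (0ℚ ℚ.< δ × Separated δ σ)
separation em {n} {k} σ σ-inj = uniform-δ
  (λ i δ → ∀ j → i ≢ j → ∃[ l ] Apart δ (σ i l) (σ j l))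
  (λ i δ≤ε far j i≢j → let l , apart = far j i≢j in l , Apart-mono {x = σ i l} {σ j l} δ≤ε apart)
  λ i → uniform-δ
    (λ j δ → i ≢ j → ∃[ l ] Apart δ (σ i l) (σ j l))
    (λ j δ≤ε far i≢j → let l , apart = far i≢j in l , Apart-mono {x = σ i l} {σ j l} δ≤ε apart)
    (pair i)
  where
  pair : ∀ i j → ∃[ δ ] (0ℚ ℚ.< δ × (i ≢ j → ∃[ l ] Apart δ (σ i l) (σ j l)))
  pair i j with i Finₚ.≟ j
  -- The diagonal imposes no condition, so any positive value serves.
  ... | yes i≡j = 1ℚ , 0<1 , λ i≢j → contradiction i≡j i≢j
  ... | no  i≢j =
    let l , σ≉ = Finₚ.¬∀⟶∃¬ k (λ l → σ i l ≈ᴿ σ j l) (λ _ → em) (λ σ≈ → i≢j (σ-inj σ≈))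
        δ , 0<δ , apart = ≉⇒Apart em {σ i l} {σ j l} σ≉
    in δ , 0<δ , λ _ → l , apart

halves : ∀ δ → δ ≡ ½ ℚ.* δ ℚ.+ ½ ℚ.* δ
halves = solve 1 (λ d → d := con ½ :* d :+ con ½ :* d) refl

-- Scaling by `r` keeps the gap of 2 δ, and the offsets δ p and δ q consume at most δ of it.
homothets-apart : ∀ {δ r a p q x y} → 0ℚ ℚ.< δ → 1ℚ ℚ.≤ r → ∣ q ℚ.- p ∣ ℚ.≤ 1ℚ →
  δ ℚ.+ δ ℚ.≤ ∣ x ℚ.- y ∣ →
  δ ℚ.≤ ∣ (δ ℚ.* p ℚ.+ a ℚ.+ r ℚ.* x) ℚ.- (δ ℚ.* q ℚ.+ a ℚ.+ r ℚ.* y) ∣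
homothets-apart {δ} {r} {a} {p} {q} {x} {y} 0<δ 1≤r pq 2δ≤ = cancel (begin
  δ ℚ.+ δ                           ≤⟨ 2δ≤ ⟩
  ∣ x ℚ.- y ∣                       ≡⟨ ℚₚ.*-identityˡ _ ⟨
  1ℚ ℚ.* ∣ x ℚ.- y ∣                ≤⟨ *-monoʳ-≤ (ℚₚ.0≤∣p∣ (x ℚ.- y)) 1≤r ⟩
  r ℚ.* ∣ x ℚ.- y ∣                 ≡⟨ ∣*∣-nonNeg (1≤⇒0≤ 1≤r) (x ℚ.- y) ⟨
  ∣ r ℚ.* (x ℚ.- y) ∣               ≡⟨ cong ∣_∣ (solve 7 (λ r x y D p q a → r :* (x :- y) :=
                                         ((D :* p :+ a :+ r :* x) :- (D :* q :+ a :+ r :* y)) :+ D :* (q :- p))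
                                         refl r x y δ p q a) ⟩
  ∣ e ℚ.+ δ ℚ.* (q ℚ.- p) ∣         ≤⟨ ℚₚ.∣p+q∣≤∣p∣+∣q∣ e (δ ℚ.* (q ℚ.- p)) ⟩
  ∣ e ∣ ℚ.+ ∣ δ ℚ.* (q ℚ.- p) ∣     ≡⟨ cong (∣ e ∣ ℚ.+_) (∣*∣-nonNeg (ℚₚ.<⇒≤ 0<δ) (q ℚ.- p)) ⟩
  ∣ e ∣ ℚ.+ δ ℚ.* ∣ q ℚ.- p ∣       ≤⟨ ℚₚ.+-monoʳ-≤ ∣ e ∣ (*-monoˡ-≤ (ℚₚ.<⇒≤ 0<δ) pq) ⟩
  ∣ e ∣ ℚ.+ δ ℚ.* 1ℚ                ≡⟨ cong (∣ e ∣ ℚ.+_) (ℚₚ.*-identityʳ δ) ⟩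
  ∣ e ∣ ℚ.+ δ                       ∎)
  where
  open ℚₚ.≤-Reasoning
  e = (δ ℚ.* p ℚ.+ a ℚ.+ r ℚ.* x) ℚ.- (δ ℚ.* q ℚ.+ a ℚ.+ r ℚ.* y)

  cancel : ∀ {p q} → p ℚ.+ δ ℚ.≤ q ℚ.+ δ → p ℚ.≤ q
  cancel {p} {q} le = ℚₚ.≮⇒≥ λ q<p → ℚₚ.<-irrefl refl (ℚₚ.<-≤-trans (ℚₚ.+-monoˡ-< δ q<p) le)

-- The common terms cancel and leave δ (p - q), with B the inverse of δ.
same-point-distance : ∀ {δ B a p q x} → 0ℚ ℚ.< B → δ ℚ.* B ≡ 1ℚ →
  ∣ p ℚ.- q ∣ ℚ.≤ B ℚ.* ∣ (δ ℚ.* p ℚ.+ a ℚ.+ x) ℚ.- (δ ℚ.* q ℚ.+ a ℚ.+ x) ∣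
same-point-distance {δ} {B} {a} {p} {q} {x} 0<B δB≡1 = ℚₚ.≤-reflexive (begin
  ∣ p ℚ.- q ∣                     ≡⟨ cong ∣_∣ (ℚₚ.*-identityˡ (p ℚ.- q)) ⟨
  ∣ 1ℚ ℚ.* (p ℚ.- q) ∣            ≡⟨ cong (λ t → ∣ t ℚ.* (p ℚ.- q) ∣) δB≡1 ⟨
  ∣ δ ℚ.* B ℚ.* (p ℚ.- q) ∣       ≡⟨ cong ∣_∣ (solve 6 (λ D B p q a x → D :* B :* (p :- q) :=
                                       B :* ((D :* p :+ a :+ x) :- (D :* q :+ a :+ x))) refl δ B p q a x) ⟩
  ∣ B ℚ.* ((δ ℚ.* p ℚ.+ a ℚ.+ x) ℚ.- (δ ℚ.* q ℚ.+ a ℚ.+ x)) ∣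
                                  ≡⟨ ∣*∣-nonNeg (ℚₚ.<⇒≤ 0<B) _ ⟩
  B ℚ.* ∣ (δ ℚ.* p ℚ.+ a ℚ.+ x) ℚ.- (δ ℚ.* q ℚ.+ a ℚ.+ x) ∣ ∎)
  where open ≡.≡-Reasoning

stretch-distance : ∀ {d} p q → 1ℚ ℚ.≤ d →
  ∣ p ℚ.- q ∣ ℚ.≤ ∣ (1ℚ ℚ.+ p) ℚ.* d ℚ.- (1ℚ ℚ.+ q) ℚ.* d ∣
stretch-distance {d} p q 1≤d = begin
  ∣ p ℚ.- q ∣               ≡⟨ ℚₚ.*-identityˡ _ ⟨
  1ℚ ℚ.* ∣ p ℚ.- q ∣        ≤⟨ *-monoʳ-≤ (ℚₚ.0≤∣p∣ (p ℚ.- q)) 1≤d ⟩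
  d ℚ.* ∣ p ℚ.- q ∣         ≡⟨ ∣*∣-nonNeg (1≤⇒0≤ 1≤d) (p ℚ.- q) ⟨
  ∣ d ℚ.* (p ℚ.- q) ∣       ≡⟨ cong ∣_∣ (solve 3 (λ d p q → d :* (p :- q) :=
                                 (con 1ℚ :+ p) :* d :- (con 1ℚ :+ q) :* d) refl d p q) ⟩
  ∣ (1ℚ ℚ.+ p) ℚ.* d ℚ.- (1ℚ ℚ.+ q) ℚ.* d ∣ ∎
  where open ℚₚ.≤-Reasoning

-- One homothety for continuum many scalings and translations

offset : ∀ {k} → ℚ → Cantor → 𝔼 k
offset δ β _ = constᴿ δ *ᴿ cantor β

stretch : Cantor → ℝ
stretch b = constᴿ 1ℚ +ᴿ cantor b

pullback : ∀ {k c} → Coloring k c → 𝔼 k → ℝ → Colouring (𝔼-+-commutativeMonoid k) c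
pullback χ a s = record
  { to   = λ x → Func.to χ (affine a s x)
  ; cong = λ {x} {y} x≈y → Func.cong χ (affine-cong a s {x} {y} x≈y) }

-- Two applications of the pigeonhole: in each row `b` one index serves continuum many β, and then
-- one index is common to continuum many rows.
cantor²-pigeonhole : ExcludedMiddle 0ℓ → ∀ {m} {P : Cantor → Cantor → Fin m → Set} →
  (∀ b β → ∃[ i ] P b β i) →
  ∃[ i ] Σ (Cantor → Cantor) λ f → Σ (Cantor → Cantor → Cantor) λ g →
    Injective _≗_ _≗_ f × (∀ b → Injective _≗_ _≗_ (g b)) × (∀ b β → P (f b) (g b β) i)
cantor²-pigeonhole em {m} {P} good =
  i , f , (λ b → proj₁ (proj₂ (row (f b)))) , proj₁ (proj₂ (proj₂ rows)) ,
  (λ b {β} {β′} → proj₁ (proj₂ (proj₂ (row (f b)))) {β} {β′}) ,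
  λ b β → subst (P _ _)
    (≡.trans (proj₂ (proj₂ (proj₂ (row (f b)))) β) (proj₂ (proj₂ (proj₂ rows)) b)) (proj₂ (good (f b) _))
  where
  row : ∀ b → ∃[ i ] Σ (Cantor → Cantor) λ g → Injective _≗_ _≗_ g × (∀ β → proj₁ (good b (g β)) ≡ i)
  row b = cantor-pigeonhole em m (λ β → proj₁ (good b β))

  rows : ∃[ i ] Σ (Cantor → Cantor) λ f → Injective _≗_ _≗_ f × (∀ b → proj₁ (row (f b)) ≡ i)
  rows = cantor-pigeonhole em m (λ b → proj₁ (row b))

  i : Fin m
  i = proj₁ rows

  f : Cantor → Cantor
  f = proj₁ (proj₂ rows)

UniformGallai : ∀ {n k c} → ℚ → Vector (𝔼 k) (suc n) → Coloring k c → Set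
UniformGallai {k = k} δ σ χ =
  ∃[ p ] Σ (Cantor → Cantor) λ f → Σ (Cantor → Cantor → Cantor) λ g →
    Injective _≗_ _≗_ f × (∀ b → Injective _≗_ _≗_ (g b)) ×
    (∀ b β → MonoUnder (𝔼-+-commutativeMonoid k) (pullback χ (offset δ (g b β)) (stretch (f b))) σ p)

-- The list `L` depends only on `c` and σ, so positions in it form a finite colouring of the pairs
-- (b, β).
gallai-uniform : ExcludedMiddle 0ℓ → ∀ {n k c} (δ : ℚ) (σ : Fin (suc n) → 𝔼 k) (χ : Coloring k c) →
  Gallai (𝔼-+-commutativeMonoid k) σ → UniformGallai δ σ χ
gallai-uniform em {n} {k} {c} δ σ χ gal =
  relabel (cantor²-pigeonhole em {P = λ b β i → Mono b β (lookup L i)} good)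
  where
  L : List (Homothety (𝔼-+-commutativeMonoid k))
  L = proj₁ (gal c)

  Mono : Cantor → Cantor → Homothety (𝔼-+-commutativeMonoid k) → Set
  Mono b β = MonoUnder (𝔼-+-commutativeMonoid k) (pullback χ (offset δ β) (stretch b)) σ

  locate : ∀ b β → ∃[ p ] p ∈ᴸ L × Mono b β p → ∃[ i ] Mono b β (lookup L i)
  locate b β (p , p∈L , mono) =
    index p∈L , subst (Mono b β) {p} {lookup L (index p∈L)} (Anyₚ.lookup-index p∈L) mono

  good : ∀ b β → ∃[ i ] Mono b β (lookup L i)
  good b β = locate b β (proj₂ (gal c) (pullback χ (offset δ β) (stretch b)))

  relabel : (∃[ i ] Σ (Cantor → Cantor) λ f → Σ (Cantor → Cantor → Cantor) λ g →
      Injective _≗_ _≗_ f × (∀ b → Injective _≗_ _≗_ (g b)) × (∀ b β → Mono (f b) (g b β) (lookup L i))) →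
    UniformGallai δ σ χ
  relabel (i , rest) = lookup L i , rest

-- The family of copies for one ratio

ManyCopies : ∀ {k c} → Pred (𝔼 k) 0ℓ → Coloring k c → ℝ → Set₁
ManyCopies {k} S χ r =
  (0ᴿ <ᴿ r) ×
  Σ (Pred (Pred (𝔼 k) 0ℓ) 0ℓ) λ 𝓕 →
    HasCardinalityOf continuum (≐-setoid (𝔼 k) 0ℓ) 𝓕 ×
    PairwiseDisjoint 𝓕 ×
    ((Y : Pred (𝔼 k) 0ℓ) → Y ∈ 𝓕 → Monochromatic χ Y × HomotheticTo S r Y)

module Copies (ext : Extensionality 0ℓ 0ℓ) {n k c} (S : Pred (𝔼 k) 0ℓ) (χ : Coloring k c)
  (σ : Vector (𝔼 k) (suc n)) (σ∈S : ∀ i → σ i ∈ S) (σ-onto : ∀ x → x ∈ S → ∃[ i ] σ i ≈ᴱ x)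
  (ratio : Cantor → ℝ) (centre : Cantor → Cantor → 𝔼 k)
  (1≤ratio : ∀ b n → 1ℚ ℚ.≤ seq (ratio b) n)
  (ratio-injective : Injective _≗_ (Setoid._≈_ ℝ-setoid) ratio)
  (disjoint : ∀ b β β′ i j →
    affine (centre b β) (ratio b) (σ i) ≈ᴱ affine (centre b β′) (ratio b) (σ j) → β ≗ β′)
  (monochromatic : ∀ b β i →
    Func.to χ (affine (centre b β) (ratio b) (σ i)) ≡ Func.to χ (affine (centre b β) (ratio b) (σ zero)))
  where

  copy : Cantor → Cantor → Pred (𝔼 k) 0ℓ
  copy b β = centre b β +[ ratio b ] S

  copy-point : ∀ b β y → y ∈ copy b β → ∃[ i ] y ≈ᴱ affine (centre b β) (ratio b) (σ i)
  copy-point b β y (x , x∈S , y≈) = let i , σi≈x = σ-onto x x∈S in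
    i , 𝔼-eq.trans {_} {y} {affine (centre b β) (ratio b) x} {affine (centre b β) (ratio b) (σ i)} y≈
          (affine-cong (centre b β) (ratio b) {x} {σ i} (𝔼-eq.sym {x = σ i} {x} σi≈x))

  copy-colour : ∀ b β y → y ∈ copy b β → Func.to χ y ≡ Func.to χ (affine (centre b β) (ratio b) (σ zero))
  copy-colour b β y y∈ = let i , y≈ = copy-point b β y y∈ in
    ≡.trans (Func.cong χ {y} {affine (centre b β) (ratio b) (σ i)} y≈) (monochromatic b β i)

  -- One common point already fixes the parameter; injectivity of `copy b` and disjointness of the
  -- copies both follow from this.
  meet⇒≗ : ∀ b β β′ y → y ∈ copy b β → y ∈ copy b β′ → β ≗ β′
  meet⇒≗ b β β′ y y∈ y∈′ =
    let i , y≈ = copy-point b β y y∈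
        j , y≈′ = copy-point b β′ y y∈′
        p = affine (centre b β) (ratio b) (σ i)
        q = affine (centre b β′) (ratio b) (σ j)
    in disjoint b β β′ i j (𝔼-eq.trans {_} {p} {y} {q} (𝔼-eq.sym {x = y} {p} y≈) y≈′)

  copy-injective : ∀ b {β β′} → copy b β ≐ copy b β′ → β ≗ β′
  copy-injective b {β} {β′} Y⊆⊇Y′ =
    meet⇒≗ b β β′ (affine (centre b β) (ratio b) (σ zero)) p∈
      (proj₁ Y⊆⊇Y′ {affine (centre b β) (ratio b) (σ zero)} p∈)
    where
    p∈ : affine (centre b β) (ratio b) (σ zero) ∈ copy b β
    p∈ = σ zero , σ∈S zero , 𝔼-eq.refl {x = affine (centre b β) (ratio b) (σ zero)}

  copy-cong : ∀ b {β β′} → β ≗ β′ → copy b β ≐ copy b β′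
  copy-cong b {β} {β′} β≗β′ = subst (λ β′ → copy b β ≐ copy b β′) (ext β≗β′) ≐-refl

  -- The terms of `r` itself may start anywhere, but they are eventually within ½ of terms that are
  -- at least 1.
  positive-ratio : ∀ r b → r ≈ᴿ ratio b → 0ᴿ <ᴿ r
  positive-ratio r b r≈ = ½ , 0<½ , proj₁ (r≈ ½ 0<½) , λ n N≤n →
    half≤ (seq (ratio b) n) (seq r n) (1≤ratio b n)
      (subst (ℚ._< ½) (∣-∣-sym (seq r n) (seq (ratio b) n)) (proj₂ (r≈ ½ 0<½) n N≤n))
    where
    half≤ : ∀ p q → 1ℚ ℚ.≤ p → ∣ p ℚ.- q ∣ ℚ.< ½ → 0ℚ ℚ.+ ½ ℚ.≤ q
    half≤ p q 1≤p p~q = begin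
      1ℚ ℚ.- ½             ≤⟨ ℚₚ.+-mono-≤ 1≤p (ℚₚ.neg-antimono-≤ (ℚₚ.≤-trans (≤-∣∣ (p ℚ.- q)) (ℚₚ.<⇒≤ p~q))) ⟩
      p ℚ.- (p ℚ.- q)      ≡⟨ solve 2 (λ p q → p :- (p :- q) := q) refl p q ⟩
      q                    ∎
      where open ℚₚ.≤-Reasoning

  copies-disjoint : ∀ b → PairwiseDisjoint (λ Y → ∃[ β ] Y ≐ copy b β)
  copies-disjoint b Y Z (β , Y⊆ , ⊆Y) (β′ , Z⊆ , ⊆Z) Y≢Z {y} (y∈Y , y∈Z) =
    Y≢Z ((λ {x} x∈Y → ⊆Z {x} (proj₁ same {x} (Y⊆ {x} x∈Y))) ,
         (λ {x} x∈Z → ⊆Y {x} (proj₂ same {x} (Z⊆ {x} x∈Z))))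
    where
    same : copy b β ≐ copy b β′
    same = copy-cong b {β} {β′} (meet⇒≗ b β β′ y (Y⊆ {y} y∈Y) (Z⊆ {y} y∈Z))

  copies-monochromatic : ∀ b β Y → Y ≐ copy b β → Monochromatic χ Y
  copies-monochromatic b β Y (Y⊆ , _) x y x∈Y y∈Y =
    ≡.trans (copy-colour b β x (Y⊆ {x} x∈Y)) (≡.sym (copy-colour b β y (Y⊆ {y} y∈Y)))

  copies-homothetic : ∀ r b β Y → r ≈ᴿ ratio b → Y ≐ copy b β → HomotheticTo S r Y
  copies-homothetic r b β Y r≈ (Y⊆ , ⊆Y) = positive-ratio r b r≈ , centre b β ,
    (λ {x} x∈Y → +[]-congʳ (centre b β) {ratio b} {r} S (ℝ-eq.sym {r} {ratio b} r≈) {x} (Y⊆ {x} x∈Y)) ,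
    (λ {x} x∈ → ⊆Y {x} (+[]-congʳ (centre b β) {r} {ratio b} S r≈ {x} x∈))

  Copies-of : Cantor → Pred (Pred (𝔼 k) 0ℓ) 0ℓ
  Copies-of b = Image (≐-setoid (𝔼 k) 0ℓ) (copy b)

  copies-cardinality : ∀ b →
    HasCardinalityOf continuum (≐-setoid (𝔼 k) 0ℓ) (Image (≐-setoid (𝔼 k) 0ℓ) (copy b))
  copies-cardinality b =
    image-cardinality ext (≐-setoid (𝔼 k) 0ℓ) (copy b) (λ {β} {β′} → copy-injective b {β} {β′})

  homothetic : ∀ r b → r ≈ᴿ ratio b →
    (Y : Pred (𝔼 k) 0ℓ) → Y ∈ Copies-of b → Monochromatic χ Y × HomotheticTo S r Y
  homothetic r b r≈ Y Y∈ =
    copies-monochromatic b (proj₁ Y∈) Y (proj₂ Y∈) , copies-homothetic r b (proj₁ Y∈) Y r≈ (proj₂ Y∈)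

  ratios-cardinality : HasCardinalityOf continuum ℝ-setoid (Image ℝ-setoid ratio)
  ratios-cardinality = image-cardinality ext ℝ-setoid ratio ratio-injective

  homothetic-copies : ∀ r → r ∈ Image ℝ-setoid ratio → ManyCopies S χ r
  homothetic-copies r r∈ = positive-ratio r (proj₁ r∈) (proj₂ r∈) , Copies-of (proj₁ r∈) ,
    copies-cardinality (proj₁ r∈) , copies-disjoint (proj₁ r∈) , homothetic r (proj₁ r∈) (proj₂ r∈)

pullback-mono : ∀ {n k c} (χ : Coloring k c) (σ : Vector (𝔼 k) (suc n)) a s a′ s′ p →
  (∀ x → affine a′ s′ x ≈ᴱ affine a s (apply (𝔼-+-commutativeMonoid k) p x)) →
  MonoUnder (𝔼-+-commutativeMonoid k) (pullback χ a s) σ p →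
  ∀ i → Func.to χ (affine a′ s′ (σ i)) ≡ Func.to χ (affine a′ s′ (σ zero))
pullback-mono {k = k} χ σ a s a′ s′ p eq mono i = ≡.trans (recolour i) (≡.trans (mono i) (≡.sym (recolour zero)))
  where
  recolour : ∀ i →
    Func.to χ (affine a′ s′ (σ i)) ≡ Func.to χ (affine a s (apply (𝔼-+-commutativeMonoid k) p (σ i)))
  recolour i = Func.cong χ
    {affine a′ s′ (σ i)} {affine a s (apply (𝔼-+-commutativeMonoid k) p (σ i))} (eq (σ i))

-- Choice of ratios and centres

module Construction {n k} (σ : Vector (𝔼 (suc k)) (suc n))
  (δ : ℚ) (0<δ : 0ℚ ℚ.< δ) (far : Separated (δ ℚ.+ δ) σ)
  (v : 𝔼 (suc k)) (e : ℕ) (f : Cantor → Cantor) (g : Cantor → Cantor → Cantor)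
  (f-inj : Injective _≗_ _≗_ f) (g-inj : ∀ b → Injective _≗_ _≗_ (g b)) where

  ratio : Cantor → ℝ
  ratio b = stretch (f b) *ᴿ constᴿ (ι (suc e))

  centre : Cantor → Cantor → 𝔼 (suc k)
  centre b β = affine (offset δ (g b β)) (stretch (f b)) v

  1≤ratio : ∀ b n → 1ℚ ℚ.≤ seq (ratio b) n
  1≤ratio b n = 1≤-* (≤-slack _ (0≤partial (f b) n) refl) (1≤ι e)

  -- Composition of homotheties: a + s (v + d x) = (a + s v) + (s d) x, where d = e + 1.
  reassociate : ∀ b β x → affine (centre b β) (ratio b) x ≈ᴱ
    affine (offset δ (g b β)) (stretch (f b)) (apply (𝔼-+-commutativeMonoid (suc k)) (v , e) x)
  reassociate b β x l = seq-≡⇒≈ᴿ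
    {affine (centre b β) (ratio b) x l}
    {affine (offset δ (g b β)) (stretch (f b)) (apply (𝔼-+-commutativeMonoid (suc k)) (v , e) x) l} λ n →
      ≡.trans (regroup (δ ℚ.* partial (g b β) n) (1ℚ ℚ.+ partial (f b) n) (seq (v l) n) (ι (suc e)) (seq (x l) n))
        (cong (λ t → δ ℚ.* partial (g b β) n ℚ.+ (1ℚ ℚ.+ partial (f b) n) ℚ.* (seq (v l) n ℚ.+ t))
          (≡.sym (seq-× (suc e) x l n)))
    where
    regroup : ∀ a s v d x → a ℚ.+ s ℚ.* v ℚ.+ s ℚ.* d ℚ.* x ≡ a ℚ.+ s ℚ.* (v ℚ.+ d ℚ.* x)
    regroup = solve 5 (λ a s v d x → a :+ s :* v :+ s :* d :* x := a :+ s :* (v :+ d :* x)) refl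

  ratio-injective : Injective _≗_ _≈ᴿ_ ratio
  ratio-injective {b} {b′} eq = f-inj (cantor-injective {f b} {f b′}
    (≈ᴿ-contract {cantor (f b)} {cantor (f b′)} {ratio b} {ratio b′}
      (λ n → stretch-distance (partial (f b) n) (partial (f b′) n) (1≤ι e)) eq))

  -- Images of the same point of σ differ only by the offset, which coordinate zero recovers; images
  -- of different points stay δ apart in the coordinate that separates them.
  disjoint : ∀ b β β′ i j →
    affine (centre b β) (ratio b) (σ i) ≈ᴱ affine (centre b β′) (ratio b) (σ j) → β ≗ β′
  disjoint b β β′ i j eq = decide (i Finₚ.≟ j)
    where
    Y : Cantor → Fin (suc n) → Fin (suc k) → ℝ
    Y β i = affine (centre b β) (ratio b) (σ i)

    coincide : Y β i zero ≈ᴿ Y β′ i zero → ∃[ B ] (0ℚ ℚ.< B × δ ℚ.* B ≡ 1ℚ) → g b β ≗ g b β′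
    coincide eq₀ (B , 0<B , δB≡1) = cantor-injective {g b β} {g b β′}
      (≈ᴿ-lipschitz {cantor (g b β)} {cantor (g b β′)} {Y β i zero} {Y β′ i zero}
        B 0<B id (λ _ → ℕₚ.≤-refl)
        (λ n → same-point-distance {δ} {B} {seq (stretch (f b) *ᴿ v zero) n}
          {partial (g b β) n} {partial (g b β′) n} {seq (ratio b *ᴿ σ i zero) n} 0<B δB≡1)
        eq₀)

    clash : ∀ l → Y β i l ≈ᴿ Y β′ j l → ¬ Apart (δ ℚ.+ δ) (σ i l) (σ j l)
    -- At an index beyond both moduli the two images would be less than δ and at least δ apart.
    clash l eqₗ (N , apart) = ℚₚ.<-irrefl refl (ℚₚ.≤-<-trans
      (homothets-apart {δ} {seq (ratio b) m} {seq (stretch (f b) *ᴿ v l) m} {partial (g b β) m} {partial (g b β′) m}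
          {seq (σ i l) m} {seq (σ j l) m}
        0<δ (1≤ratio b m) (partial-distance (g b β′) (g b β) m m) (apart m (ℕₚ.m≤m⊔n N N′)))
      (proj₂ (eqₗ δ 0<δ) m (ℕₚ.m≤n⊔m N N′)))
      where
      N′ m : ℕ
      N′ = proj₁ (eqₗ δ 0<δ)
      m = N ℕ.⊔ N′

    decide : Dec (i ≡ j) → β ≗ β′
    decide (yes i≡j) = g-inj b (coincide
      (subst (λ j → Y β i zero ≈ᴿ Y β′ j zero) (≡.sym i≡j) (eq zero)) (scale δ 1ℚ 0<δ 0<1))
    decide (no i≢j) = let l , apart = far i j i≢j in contradiction apart (clash l (eq l))

  monochromatic : ∀ {c} (χ : Coloring (suc k) c) b β →
    MonoUnder (𝔼-+-commutativeMonoid (suc k)) (pullback χ (offset δ (g b β)) (stretch (f b))) σ (v , e) →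
    ∀ i → Func.to χ (affine (centre b β) (ratio b) (σ i)) ≡ Func.to χ (affine (centre b β) (ratio b) (σ zero))
  monochromatic χ b β = pullback-mono χ σ (offset δ (g b β)) (stretch (f b)) (centre b β) (ratio b) (v , e)
    (reassociate b β)

theorem2p4 : ExcludedMiddle 0ℓ → Extensionality 0ℓ 0ℓ →
    (n k : ℕ) → 1 ≤ n → 1 ≤ k → k < n →
    (S : Pred (𝔼 k) 0ℓ) →
    HasCardinalityOf (finite n) (𝔼-setoid k) S →
    ((H : Pred (𝔼 k) 0ℓ) → IsAffineSubspace (k ∸ 1) H → ¬ (S ⊆ H)) →
    (c : ℕ) → 1 ≤ c → (χ : Coloring k c) →
    Σ (Pred ℝ 0ℓ) λ T →
    HasCardinalityOf continuum ℝ-setoid T ×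
    ((r : ℝ) → r ∈ T →
    (0ᴿ <ᴿ r) ×
    Σ (Pred (Pred (𝔼 k) 0ℓ) 0ℓ) λ 𝓕 →
    HasCardinalityOf continuum (≐-setoid (𝔼 k) 0ℓ) 𝓕 ×
    PairwiseDisjoint 𝓕 ×
    ((Y : Pred (𝔼 k) 0ℓ) → Y ∈ 𝓕 →
    Monochromatic χ Y × HomotheticTo S r Y))
theorem2p4 em ext (suc n) (suc k) _ _ _ S S-card _ c _ χ =
  assemble (separation em σ λ {i} {j} → injective {i} {j})
  where
  open Bijection S-card using (to; injective; strictlySurjective)

  σ : Vector (𝔼 (suc k)) (suc n)
  σ = proj₁ ∘ to

  Conclusion : Set₁
  Conclusion = Σ (Pred ℝ 0ℓ) λ T → HasCardinalityOf continuum ℝ-setoid T × (∀ r → r ∈ T → ManyCopies S χ r)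

  assemble : ∃[ δ ] (0ℚ ℚ.< δ × Separated δ σ) → Conclusion
  -- Half the separation is the scale of the offsets, so that points of σ are twice that scale
  -- apart. It must be fixed before the colourings are pulled back.
  assemble (δ , 0<δ , far) = select (gallai-uniform em (½ ℚ.* δ) σ χ (gallai (𝔼-+-commutativeMonoid (suc k)) n σ))
    where
    select : UniformGallai (½ ℚ.* δ) σ χ → Conclusion
    select ((v , e) , f , g , f-inj , g-inj , mono) =
      Image ℝ-setoid ratio , ratios-cardinality , homothetic-copies
      where
      open Construction σ (½ ℚ.* δ) (0<-* 0<½ 0<δ) (subst (λ δ → Separated δ σ) (halves δ) far)
        v e f g f-inj g-inj
      open Copies ext S χ σ (proj₂ ∘ to) (λ x x∈S → strictlySurjective (x , x∈S))
        ratio centre 1≤ratio (λ {b} {b′} → ratio-injective {b} {b′}) disjoint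
        (λ b β → monochromatic χ b β (mono b β))
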